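{- Let $G \subset \mathbb{F}_q^k$ be an arc and let $n \in \mathbb{N}$ be a natural number such that \[ n+k-1 \le |G| \le \frac{q+2k-2+n}{2}. \] If the matrix $M_G^{\uparrow n}$ (constructed with respect to a basis $B$ of $\mathbb{F}_q^k$) has full row rank over $\mathbb{F}_q$, then the arc $G$ cannot be extended to an arc of size $q+2k-1+n-|G|$, i.e. there is no arc $S\subset\mathbb{F}_q^k$ of size $q+2k-1+n-|G|$ containing $G$ as a subfamily.
   Context: $\mathbb{F}_q$ is a finite field of order $q$ and characteristic $p$. An arc in $\mathbb{F}_q^k$ is an ordered family of at least $k$ vectors in which every subfamily of size $k$ is a basis of $\mathbb{F}_q^k$; subfamilies inherit the order. For a finite set $X$, $\binom{X}{m}$ denotes the set of $m$-element subsets of $X$. For a basis $B$ of $\mathbb{F}_q^k$, a vector $u$ and $C\in\binom{G}{k-1}$, $\det(u,C)_B$ denotes the determinant of the $k\times k$ matrix whose first row is $u$ written in coordinates with respect to $B$ and whose last $k-1$ rows are the elements of $C$ written with respect to $B$ in the order inherited from $G$. For an arc $G$ and $0\le n\le |G|-k+1$, $M_G^{\uparrow n}$ is the matrix over $\mathbb{F}_q$ whose rows are indexed by $\binom{G}{k-1}$, whose columns are indexed by ordered pairs $(U,A)$ with $U\in\binom{G}{n}$ and $A\in\binom{G\setminus U}{k-2}$, and whose $(C,(U,A))$-entry is $\prod_{u\in U}\det(u,C)_B$ if $A\subset C\subset G\setminus U$ and $0$ otherwise. -}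

module Defs where

open import Level using (0ℓ)
open import Algebra.Bundles using (CommutativeRing)
open import Data.Nat as ℕ using (ℕ; zero; suc; _≤_; _<_)
open import Data.Fin as Fin using (Fin; zero; suc; punchIn; toℕ)
open import Data.Fin.Subset using (Subset; inside; outside; ∣_∣; _⊆_; ∁)
open import Data.Fin.Subset.Properties using (_⊆?_)
open import Data.Vec as Vec using (Vec; []; _∷_)
open import Data.List using (List; []; _∷_; length; map; _++_)
open import Data.List.Relation.Unary.Any using (Any)
import Data.List.Relation.Unary.Unique.Setoid as UniqueS
open import Data.Product using (Σ; ∃; _×_; _,_; proj₁)
open import Relation.Nullary using (¬_; Dec; yes; no; does)
open import Data.Bool using (if_then_else_; _∧_)
open import Relation.Binary.PropositionalEquality using (_≡_; sym; refl)

record FiniteField : Set₁ where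
  field
    commRing : CommutativeRing 0ℓ 0ℓ
  open CommutativeRing commRing public
  field
    1≉0      : ¬ (1# ≈ 0#)
    inverse  : ∀ x → ¬ (x ≈ 0#) → ∃ λ y → x * y ≈ 1#
    elements : List Carrier
    complete : ∀ x → Any (x ≈_) elements
    distinct : UniqueS.Unique setoid elements

  order : ℕ
  order = length elements

allSubsets : ∀ m → List (Subset m)
allSubsets zero    = [] ∷ []
allSubsets (suc m) = map (inside ∷_) (allSubsets m) ++ map (outside ∷_) (allSubsets m)

toVec : ∀ {m} (s : Subset m) → Vec (Fin m) ∣ s ∣
toVec {zero}  []            = []
toVec {suc m} (inside ∷ s)  = zero ∷ Vec.map suc (toVec s)
toVec {suc m} (outside ∷ s) = Vec.map suc (toVec s)

elemAt : ∀ {m j} (s : Subset m) → ∣ s ∣ ≡ j → Fin j → Fin m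
elemAt s e i = Vec.lookup (toVec s) (Fin.cast (sym e) i)

StrictlyIncreasing : ∀ {m N} → (Fin m → Fin N) → Set
StrictlyIncreasing ι = ∀ i j → toℕ i < toℕ j → toℕ (ι i) < toℕ (ι j)

module LinAlg (F : FiniteField) where
  open FiniteField F using (Carrier; _≈_; _+_; _*_; -_; 0#; 1#)

  Vect : ℕ → Set
  Vect k = Fin k → Carrier

  sumF : ∀ {n} → (Fin n → Carrier) → Carrier
  sumF {zero}  f = 0#
  sumF {suc n} f = f zero + sumF (λ i → f (suc i))

  prodF : ∀ {n} → (Fin n → Carrier) → Carrier
  prodF {zero}  f = 1#
  prodF {suc n} f = f zero * prodF (λ i → f (suc i))

  sumL : ∀ {A : Set} → List A → (A → Carrier) → Carrier
  sumL []       f = 0#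
  sumL (x ∷ xs) f = f x + sumL xs f

  sign : ∀ {n} → Fin n → Carrier
  sign zero    = 1#
  sign (suc j) = - sign j

  det : ∀ {k} → (Fin k → Fin k → Carrier) → Carrier
  det {zero}  M = 1#
  det {suc k} M = sumF λ j → sign j * (M zero j * det (λ r c → M (suc r) (punchIn j c)))

  lincomb : ∀ {j k} → (Fin j → Carrier) → (Fin j → Vect k) → Vect k
  lincomb c v t = sumF λ i → c i * v i t

  record IsBasis {k : ℕ} (v : Fin k → Vect k) : Set where
    field
      independent : ∀ (c : Fin k → Carrier) → (∀ t → lincomb c v t ≈ 0#) → ∀ i → c i ≈ 0#
      spanning    : ∀ (w : Vect k) → Σ (Fin k → Carrier) λ c → ∀ t → lincomb c v t ≈ w t

  coords : ∀ {k} {B : Fin k → Vect k} → IsBasis B → Vect k → Fin k → Carrier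
  coords isB w = proj₁ (IsBasis.spanning isB w)

  subfamily : ∀ {k m j} → (Fin m → Vect k) → (s : Subset m) → ∣ s ∣ ≡ j → Fin j → Vect k
  subfamily G s e i = G (elemAt s e i)

  IsArc : ∀ k {m} → (Fin m → Vect k) → Set
  IsArc k {m} G = k ≤ m × (∀ (s : Subset m) (e : ∣ s ∣ ≡ k) → IsBasis (subfamily G s e))

  IsSubfamilyOf : ∀ {k m N} → (Fin m → Vect k) → (Fin N → Vect k) → Set
  IsSubfamilyOf {m = m} {N} G S =
    Σ (Fin m → Fin N) λ ι → StrictlyIncreasing ι × (∀ i t → S (ι i) t ≈ G i t)

  -- The matrix M_G^{↑n}, for k = suc d, w.r.t. the basis B.
  module Mat {d m : ℕ} (G : Fin m → Vect (suc d)) {B : Fin (suc d) → Vect (suc d)} (isB : IsBasis B) where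

    detUC : Vect (suc d) → (C : Subset m) → ∣ C ∣ ≡ d → Carrier
    detUC u C e = det M
      where
      M : Fin (suc d) → Fin (suc d) → Carrier
      M zero    = coords isB u
      M (suc r) = coords isB (subfamily G C e r)

    prodU : (U : Subset m) → (C : Subset m) → ∣ C ∣ ≡ d → Carrier
    prodU U C e = prodF λ i → detUC (subfamily G U refl i) C e

    entry : (C : Subset m) → ∣ C ∣ ≡ d → (U A : Subset m) → Carrier
    entry C e U A =
      if does (A ⊆? C) ∧ does (C ⊆? ∁ U) then prodU U C e else 0#

    -- M_G^{↑n} has full row rank: its rows are linearly independent over 𝔽_q.
    -- Rows: C ∈ (G choose k-1); columns: (U, A), |U| = n, A ⊆ G∖U, |A| = k-2.
    FullRowRank : ℕ → Set
    FullRowRank n =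
      ∀ (c : (C : Subset m) → ∣ C ∣ ≡ d → Carrier) →
      (∀ (U A : Subset m) → ∣ U ∣ ≡ n → ∣ A ∣ ℕ.+ 2 ≡ suc d → A ⊆ ∁ U →
         sumL (allSubsets m) (λ C → rowTerm c C U A) ≈ 0#) →
      ∀ (C : Subset m) (e : ∣ C ∣ ≡ d) → c C e ≈ 0#
      where
      rowTerm : ((C : Subset m) → ∣ C ∣ ≡ d → Carrier) → Subset m → Subset m → Subset m → Carrier
      rowTerm c C U A with ∣ C ∣ ℕ.≟ d
      ... | yes e = c C e * entry C e U A
      ... | no _  = 0#

{-# OPTIONS --safe #-}

-- Write D(u, y) = det(u, y, A). The vector c with entries
--   c(C) = ∏_{s ∈ S∖C} det(s, C)⁻¹ · ∏_{z ∈ G∖C} det(z, C)⁻¹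
-- has no zero entry, and it lies in the left kernel of M_G^{↑n}: its product with the
-- column (U, A) is, with E = G∖(A ∪ U) and I = S∖A,
--   Σ_{x ∈ E} ∏_{s ∈ I∖x} D(s, x)⁻¹ · ∏_{z ∈ E∖x} D(z, x)⁻¹,
-- where the signs from reordering C = A ∪ {x} disappear because there are q + 1 factors.
-- That this sum vanishes when |I| + |E| = q + 3 is shown by induction on |E|. If |E| > 2,
-- choose a, b ∈ E and w = a + c b independent of every vector of I; then
-- D(w, x) = D(a, x) + c D(b, x) writes the sum as a combination of the sums for
-- (I ∪ {w}, E∖a) and (I ∪ {w}, E∖b). If |E| = 2, then I meets every direction of the plane
-- V / ⟨A⟩, and x ↦ ∏_{s ∈ I∖x} D(s, x) is constant on I. |E| = 1 is impossible.
module Submission where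

open import Defs
open import Level using (0ℓ)
open import Data.Bool using (true; false; if_then_else_)
open import Data.Empty using (⊥)
open import Data.Fin as Fin using (Fin; zero; suc; punchIn)
import Data.Fin.Properties as Fin
open import Data.Fin.Subset using (Subset; inside; outside; ∣_∣; _⊆_; ∁; _∈_; _∉_) renaming (⊥ to ∅)
import Data.Fin.Subset.Properties as Subset
open import Data.List using (List; []; _∷_; length; map; _++_; allFin; tabulate)
import Data.List.Membership.Setoid as MemberS
import Data.List.Membership.Setoid.Properties as MemberSP
open import Data.List.Membership.Propositional using () renaming (_∈_ to _∈ₗ_)
import Data.List.Membership.Propositional.Properties as ∈ₗ
import Data.List.Properties as List
open import Data.List.Relation.Binary.Pointwise using (Pointwise; []; _∷_)
import Data.List.Relation.Binary.Permutation.Propositional as Perm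
import Data.List.Relation.Binary.Permutation.Propositional.Properties as PermP
import Data.List.Relation.Binary.Permutation.Setoid as PermS
import Data.List.Relation.Binary.Permutation.Setoid.Properties as PermSP
open import Data.List.Relation.Unary.All as All using (All; []; _∷_)
import Data.List.Relation.Unary.All.Properties as All
open import Data.List.Relation.Unary.AllPairs as AllPairs using (AllPairs; []; _∷_)
import Data.List.Relation.Unary.AllPairs.Properties as AllPairsP
open import Data.List.Relation.Unary.Any using (here; there)
open import Data.List.Relation.Unary.Unique.Propositional using (Unique)
import Data.List.Relation.Unary.Unique.Propositional.Properties as Unique
import Data.List.Relation.Unary.Unique.Setoid as UniqueS
import Data.List.Relation.Unary.Unique.Setoid.Properties as UniqueSP
open import Data.Nat as ℕ using (ℕ; zero; suc; _≤_; _<_; z≤n; s≤s)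
import Data.Nat.Properties as ℕ
import Data.Nat.Solver as ℕ
open import Data.Product using (Σ; ∃; _×_; _,_; proj₁; proj₂)
open import Data.Sum using (_⊎_; inj₁; inj₂)
open import Data.Unit using (⊤; tt)
open import Data.Vec as Vec using (Vec; []; _∷_; lookup; _[_]≔_; toList; cast; here; there)
import Data.Vec.Properties as Vec
open import Data.Vec.Membership.Propositional using () renaming (_∈_ to _∈ᵥ_)
import Data.Vec.Membership.Propositional.Properties as ∈ᵥ
open import Data.Vec.Relation.Unary.Any using () renaming (here to hereᵥ; there to thereᵥ)
open import Function using (_∘_; id)
open import Function.Definitions using (Injective)
open import Relation.Binary.Bundles using (Setoid)
open import Relation.Binary.Definitions using (tri<; tri≈; tri>)
open import Relation.Binary.PropositionalEquality as ≡ using (_≡_; _≢_; _≗_)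
open import Relation.Nullary using (¬_; Dec; yes; no)
open import Relation.Nullary.Negation using (contradiction)

-- The second product in c(C) is there for the column's factor ∏_{u ∈ U} det(u, C), which cancels
-- its factors over U; the sizes of S and G then give |I| + |E| = q + 3 for every column, whatever n
-- is. An induction step trades a vector of E for a new one in I, so the total is kept. For w to
-- exist, c has to avoid 0 and the |I| - 2 distinct ratios D(s, a) / D(s, b) of the other vectors of
-- I. This is possible as long as |I| ≤ q, that is, as long as |E| ≥ 3. At |E| = 2 the set I has q +
-- 1 members, one for each direction of the plane, and |E| = 1 would ask for q + 2 directions. The
-- determinant enters only as an alternating multilinear form with value 1 on B. Such a form
-- vanishes identically once it vanishes on a spanning tuple, which yields nonzero values on the
-- arc, and its contraction with A satisfies the three-term Plücker relation, which makes the ratios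
-- distinct.

module Complement (S : Setoid 0ℓ 0ℓ) where
  open Setoid S
  open MemberS S using () renaming (_∈_ to _∈ˢ_)
  open PermS S
  open UniqueS S using () renaming (Unique to Uniqueˢ)

  extract : ∀ {x xs} → x ∈ˢ xs → ∃ λ ys → xs ↭ x ∷ ys
  extract {xs = y ∷ xs} (here p)  = xs , prep (Setoid.sym S p) ↭-refl
  extract {xs = y ∷ xs} (there q) with extract q
  ... | ys , p = y ∷ ys , ↭-trans (↭-prep y p) (↭-swap y _ ↭-refl)

  -- Members of `xs` are split off `ys` one at a time; `x∉` rules out that the next one is among
  -- those already split off. Serves both for field elements up to `_≈_` and for indices up to
  -- `_≡_`.
  complement : ∀ {xs ys} → Uniqueˢ xs → All (_∈ˢ ys) xs → ∃ λ zs → ys ↭ xs ++ zs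
  complement {[]}     {ys} _        _        = ys , ↭-refl
  complement {x ∷ xs} {ys} (x∉ ∷ u) (x∈ ∷ s) with complement u s
  ... | zs , p with MemberSP.∈-++⁻ S xs (PermSP.∈-resp-↭ S p x∈)
  ...   | inj₁ x∈xs = contradiction x∈xs (All.All¬⇒¬Any x∉)
  ...   | inj₂ x∈zs with extract x∈zs
  ...     | zs′ , q = zs′ , ↭-trans p (↭-trans (PermSP.++⁺ˡ S xs q) (PermSP.↭-shift S xs zs′))

open Perm using (_↭_; prep; swap)

-- Finite fields: decidable equality, total inverses, products over all elements, signs

module Field (F : FiniteField) where
  open FiniteField F hiding (zero)
  open LinAlg F
  open import Algebra.Properties.Ring ring public
  open import Relation.Binary.Reasoning.Setoid setoid public
  open import Algebra.Solver.Ring.NaturalCoefficients.Default commutativeSemiring public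
    using (solve; _:+_; _:*_; _:=_)
  open UniqueS setoid using () renaming (Unique to Uniqueˢ)
  open MemberS setoid using () renaming (_∈_ to _∈ˢ_)

  infix 4 _≈?_

  private
    -- Equality is read off positions in the enumeration: different positions of a duplicate-free
    -- list hold different elements.
    decide : ∀ {xs x y} → Uniqueˢ xs → x ∈ˢ xs → y ∈ˢ xs → Dec (x ≈ y)
    decide _        (here p)  (here q)  = yes (trans p (sym q))
    decide (z ∷ _)  (here p)  (there q) =
      no λ x≈y → All.All¬⇒¬Any z (MemberSP.∈-resp-≈ setoid (trans (sym x≈y) p) q)
    decide (z ∷ _)  (there p) (here q)  =
      no λ x≈y → All.All¬⇒¬Any z (MemberSP.∈-resp-≈ setoid (trans x≈y q) p)
    decide (_ ∷ u)  (there p) (there q) = decide u p q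

  _≈?_ : ∀ x y → Dec (x ≈ y)
  x ≈? y = decide distinct (complete x) (complete y)

  -- The convention inv 0 = 1 lets products of inverses run over index sets on
  -- which some of the factors vanish.
  inv : Carrier → Carrier
  inv x with x ≈? 0#
  ... | yes _   = 1#
  ... | no  x≉0 = proj₁ (inverse x x≉0)

  inv-zero : ∀ {x} → x ≈ 0# → inv x ≈ 1#
  inv-zero {x} x≈0 with x ≈? 0#
  ... | yes _   = refl
  ... | no  x≉0 = contradiction x≈0 x≉0

  inv-inverse : ∀ {x} → x ≉ 0# → x * inv x ≈ 1#
  inv-inverse {x} x≉0 with x ≈? 0#
  ... | yes x≈0  = contradiction x≈0 x≉0
  ... | no  x≉0′ = proj₂ (inverse x x≉0′)

  *-cancel : ∀ {x y z} → x ≉ 0# → x * y ≈ x * z → y ≈ z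
  *-cancel {x} {y} {z} x≉0 eq = begin
    y                ≈⟨ lemma y ⟨
    inv x * (x * y)  ≈⟨ *-congˡ eq ⟩
    inv x * (x * z)  ≈⟨ lemma z ⟩
    z                ∎
    where
    lemma : ∀ w → inv x * (x * w) ≈ w
    lemma w = begin
      inv x * (x * w) ≈⟨ solve 3 (λ i x w → i :* (x :* w) := (x :* i) :* w) refl (inv x) x w ⟩
      (x * inv x) * w ≈⟨ *-congʳ (inv-inverse x≉0) ⟩
      1# * w          ≈⟨ *-identityˡ w ⟩
      w               ∎

  inv-unique : ∀ {x y} → x * y ≈ 1# → inv x ≈ y
  inv-unique {x} {y} xy≈1 = *-cancel x≉0 (trans (inv-inverse x≉0) (sym xy≈1))
    where
    x≉0 : x ≉ 0#
    x≉0 x≈0 = 1≉0 (trans (sym xy≈1) (trans (*-congʳ x≈0) (zeroˡ y)))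

  inv-cong : ∀ {x y} → x ≈ y → inv x ≈ inv y
  inv-cong {x} {y} x≈y with y ≈? 0#
  ... | yes y≈0 = inv-zero (trans x≈y y≈0)
  ... | no  y≉0 = inv-unique (trans (*-congʳ x≈y) (proj₂ (inverse y y≉0)))

  inv≉0 : ∀ x → inv x ≉ 0#
  inv≉0 x inv≈0 with x ≈? 0#
  ... | yes _   = 1≉0 inv≈0
  ... | no  x≉0 = 1≉0 (trans (sym (proj₂ (inverse x x≉0))) (trans (*-congˡ inv≈0) (zeroʳ x)))

  *-nonzero : ∀ {x y} → x ≉ 0# → y ≉ 0# → x * y ≉ 0#
  *-nonzero {x} x≉0 y≉0 xy≈0 = y≉0 (*-cancel x≉0 (trans xy≈0 (sym (zeroʳ x))))

  -‿nonzero : ∀ {x} → x ≉ 0# → - x ≉ 0#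
  -‿nonzero {x} x≉0 -x≈0 = x≉0 (begin
    x       ≈⟨ -‿involutive x ⟨
    - (- x) ≈⟨ -‿cong -x≈0 ⟩
    - 0#    ≈⟨ -0#≈0# ⟩
    0#      ∎)

  -x*-y≈x*y : ∀ x y → - x * - y ≈ x * y
  -x*-y≈x*y x y = begin
    - x * - y   ≈⟨ -‿distribˡ-* x (- y) ⟨
    - (x * - y) ≈⟨ -‿cong (-‿distribʳ-* x y) ⟨
    - - (x * y) ≈⟨ -‿involutive _ ⟩
    x * y       ∎

  inv-neg : ∀ {x} → x ≉ 0# → inv (- x) ≈ - inv x
  inv-neg {x} x≉0 = inv-unique (trans (-x*-y≈x*y x (inv x)) (inv-inverse x≉0))

  prodL : ∀ {A : Set} → List A → (A → Carrier) → Carrier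
  prodL []       f = 1#
  prodL (x ∷ xs) f = f x * prodL xs f

  module _ {A : Set} where

    prodL-cong : ∀ (xs : List A) {f g : A → Carrier} → All (λ x → f x ≈ g x) xs →
                 prodL xs f ≈ prodL xs g
    prodL-cong []       []       = refl
    prodL-cong (x ∷ xs) (p ∷ ps) = *-cong p (prodL-cong xs ps)

    prodL-one : ∀ (xs : List A) {f : A → Carrier} → All (λ x → f x ≈ 1#) xs → prodL xs f ≈ 1#
    prodL-one []       []       = refl
    prodL-one (x ∷ xs) (p ∷ ps) = trans (*-cong p (prodL-one xs ps)) (*-identityˡ 1#)

    prodL-++ : ∀ (xs : List A) {ys f} → prodL (xs ++ ys) f ≈ prodL xs f * prodL ys f
    prodL-++ []       = sym (*-identityˡ _)
    prodL-++ (x ∷ xs) = trans (*-congˡ (prodL-++ xs)) (sym (*-assoc _ _ _))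

    prodL-* : ∀ (xs : List A) (f g : A → Carrier) →
              prodL xs (λ x → f x * g x) ≈ prodL xs f * prodL xs g
    prodL-* []       f g = sym (*-identityˡ 1#)
    prodL-* (x ∷ xs) f g = trans (*-congˡ (prodL-* xs f g))
      (solve 4 (λ a b c d → (a :* b) :* (c :* d) := (a :* c) :* (b :* d)) refl _ _ _ _)

    prodL≉0 : ∀ (xs : List A) {f : A → Carrier} → (∀ x → f x ≉ 0#) → prodL xs f ≉ 0#
    prodL≉0 []       f≉0 = 1≉0
    prodL≉0 (x ∷ xs) f≉0 = *-nonzero (f≉0 x) (prodL≉0 xs f≉0)

    prodL-↭ : ∀ {xs ys : List A} {f : A → Carrier} → xs ↭ ys → prodL xs f ≈ prodL ys f
    prodL-↭ Perm.refl        = refl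
    prodL-↭ (prep x p)       = *-congˡ (prodL-↭ p)
    prodL-↭ (swap x y p)     = trans (*-congˡ (*-congˡ (prodL-↭ p)))
      (solve 3 (λ a b c → a :* (b :* c) := b :* (a :* c)) refl _ _ _)
    prodL-↭ (Perm.trans p q) = trans (prodL-↭ p) (prodL-↭ q)

    sumL-cong : ∀ (xs : List A) {f g : A → Carrier} → All (λ x → f x ≈ g x) xs →
                sumL xs f ≈ sumL xs g
    sumL-cong []       []       = refl
    sumL-cong (x ∷ xs) (p ∷ ps) = +-cong p (sumL-cong xs ps)

    sumL-zero : ∀ (xs : List A) {f : A → Carrier} → All (λ x → f x ≈ 0#) xs → sumL xs f ≈ 0#
    sumL-zero []       []       = refl
    sumL-zero (x ∷ xs) (p ∷ ps) = trans (+-cong p (sumL-zero xs ps)) (+-identityˡ 0#)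

    sumL-++ : ∀ (xs : List A) {ys f} → sumL (xs ++ ys) f ≈ sumL xs f + sumL ys f
    sumL-++ []       = sym (+-identityˡ _)
    sumL-++ (x ∷ xs) = trans (+-congˡ (sumL-++ xs)) (sym (+-assoc _ _ _))

    sumL-+ : ∀ (xs : List A) (f g : A → Carrier) →
             sumL xs (λ x → f x + g x) ≈ sumL xs f + sumL xs g
    sumL-+ []       f g = sym (+-identityˡ 0#)
    sumL-+ (x ∷ xs) f g = trans (+-congˡ (sumL-+ xs f g))
      (solve 4 (λ a b c d → (a :+ b) :+ (c :+ d) := (a :+ c) :+ (b :+ d)) refl _ _ _ _)

    sumL-scale : ∀ (xs : List A) a (f : A → Carrier) → sumL xs (λ x → a * f x) ≈ a * sumL xs f
    sumL-scale []       a f = sym (zeroʳ a)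
    sumL-scale (x ∷ xs) a f = trans (+-congˡ (sumL-scale xs a f)) (sym (distribˡ a _ _))

    sumL-↭ : ∀ {xs ys : List A} {f : A → Carrier} → xs ↭ ys → sumL xs f ≈ sumL ys f
    sumL-↭ Perm.refl        = refl
    sumL-↭ (prep x p)       = +-congˡ (sumL-↭ p)
    sumL-↭ (swap x y p)     = trans (+-congˡ (+-congˡ (sumL-↭ p)))
      (solve 3 (λ a b c → a :+ (b :+ c) := b :+ (a :+ c)) refl _ _ _)
    sumL-↭ (Perm.trans p q) = trans (sumL-↭ p) (sumL-↭ q)

  module _ {A B : Set} where

    prodL-map : ∀ (g : A → B) xs {f : B → Carrier} → prodL (map g xs) f ≡ prodL xs (f ∘ g)
    prodL-map g []           = ≡.refl
    prodL-map g (x ∷ xs) {f} = ≡.cong (f (g x) *_) (prodL-map g xs)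

    sumL-map : ∀ (g : A → B) xs {f : B → Carrier} → sumL (map g xs) f ≡ sumL xs (f ∘ g)
    sumL-map g []           = ≡.refl
    sumL-map g (x ∷ xs) {f} = ≡.cong (f (g x) +_) (sumL-map g xs)

  open Complement setoid using (complement)
  private module ↭ₛ = PermS setoid

  private
    fill : ∀ {xs} → Uniqueˢ xs → ∃ λ zs → elements ↭ₛ.↭ xs ++ zs
    fill {xs} u = complement u (All.universal complete xs)

    length-fill : ∀ xs {zs} → elements ↭ₛ.↭ xs ++ zs → order ≡ length xs ℕ.+ length zs
    length-fill xs p = ≡.trans (PermSP.xs↭ys⇒|xs|≡|ys| setoid p) (List.length-++ xs)

    prod-inv-↭ : ∀ {xs ys} → xs ↭ₛ.↭ ys → prodL xs inv ≈ prodL ys inv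
    prod-inv-↭ (↭ₛ.refl xs≋ys) = pointwise xs≋ys
      where
      pointwise : ∀ {xs ys} → Pointwise _≈_ xs ys → prodL xs inv ≈ prodL ys inv
      pointwise []       = refl
      pointwise (p ∷ ps) = *-cong (inv-cong p) (pointwise ps)
    prod-inv-↭ (↭ₛ.prep p ps)    = *-cong (inv-cong p) (prod-inv-↭ ps)
    prod-inv-↭ (↭ₛ.swap p q ps)  = trans (*-cong (inv-cong p) (*-cong (inv-cong q) (prod-inv-↭ ps)))
      (solve 3 (λ a b c → a :* (b :* c) := b :* (a :* c)) refl _ _ _)
    prod-inv-↭ (↭ₛ.trans ps qs)  = trans (prod-inv-↭ ps) (prod-inv-↭ qs)

  unique-length-≤ : ∀ {xs} → Uniqueˢ xs → length xs ≤ order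
  unique-length-≤ {xs} u with fill u
  ... | zs , p = ≡.subst (length xs ≤_) (≡.sym (length-fill xs p)) (ℕ.m≤m+n _ _)

  fresh : ∀ {xs} → Uniqueˢ xs → length xs < order → ∃ λ c → All (c ≉_) xs
  fresh {xs} u lt with fill u
  ... | []     , p = contradiction (≡.trans (≡.sym (ℕ.+-identityʳ _)) (≡.sym (length-fill xs p))) (ℕ.<⇒≢ lt)
  ... | z ∷ zs , p with PermSP.Unique-resp-↭ setoid (↭ₛ.↭-trans p (PermSP.↭-shift setoid xs zs)) distinct
  ...   | z∉ ∷ _ = z , All.++⁻ˡ xs z∉

  -- Nothing is left over when such a list is completed to the enumeration, so it is a rearrangement
  -- of the whole field. The value inv 0 = 1 keeps the product nonzero although 0 is listed.
  full-product : ∀ {xs} → Uniqueˢ xs → length xs ≡ order → prodL xs inv ≈ prodL elements inv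
  full-product {xs} u eq with fill u
  ... | []     , p = sym (≡.subst (λ ys → prodL elements inv ≈ prodL ys inv) (List.++-identityʳ xs) (prod-inv-↭ p))
  ... | z ∷ zs , p = contradiction (≡.trans eq (length-fill xs p)) (ℕ.m≢1+m+n (length xs) ∘ λ q → ≡.trans q (ℕ.+-suc (length xs) (length zs)))

  [-1]^_ : ℕ → Carrier
  [-1]^ zero  = 1#
  [-1]^ suc n = - ([-1]^ n)

  [-1]^-+ : ∀ m n → [-1]^ (m ℕ.+ n) ≈ [-1]^ m * [-1]^ n
  [-1]^-+ zero    n = sym (*-identityˡ _)
  [-1]^-+ (suc m) n = trans (-‿cong ([-1]^-+ m n)) (-‿distribˡ-* _ _)

  [-1]^-cases : ∀ n → [-1]^ n ≈ 1# ⊎ [-1]^ n ≈ - 1#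
  [-1]^-cases zero = inj₁ refl
  [-1]^-cases (suc n) with [-1]^-cases n
  ... | inj₁ p = inj₂ (-‿cong p)
  ... | inj₂ p = inj₁ (trans (-‿cong p) (-‿involutive 1#))

  [-1]^≉0 : ∀ n → [-1]^ n ≉ 0#
  [-1]^≉0 zero    = 1≉0
  [-1]^≉0 (suc n) = -‿nonzero ([-1]^≉0 n)

  data OneZero {A : Set} (f : A → Carrier) : List A → Set where
    here  : ∀ {x xs} → f x ≈ 0# → All (λ y → f y ≉ 0#) xs → OneZero f (x ∷ xs)
    there : ∀ {x xs} → f x ≉ 0# → OneZero f xs → OneZero f (x ∷ xs)

  module _ {A : Set} {f : A → Carrier} where

    prod-inv-neg : ∀ {xs} → All (λ x → f x ≉ 0#) xs →
                   prodL xs (inv ∘ -_ ∘ f) ≈ [-1]^ length xs * prodL xs (inv ∘ f)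
    prod-inv-neg []                = sym (*-identityˡ 1#)
    prod-inv-neg {x ∷ xs} (p ∷ ps) = begin
      inv (- f x) * prodL xs (inv ∘ -_ ∘ f)  ≈⟨ *-cong (inv-neg p) (prod-inv-neg ps) ⟩
      - inv (f x) * (σ * P)                  ≈⟨ -‿distribˡ-* _ _ ⟨
      - (inv (f x) * (σ * P))                ≈⟨ -‿cong (solve 3 (λ i s p → i :* (s :* p) := s :* (i :* p)) refl _ _ _) ⟩
      - (σ * (inv (f x) * P))                ≈⟨ -‿distribˡ-* _ _ ⟩
      - σ * (inv (f x) * P)                  ∎
      where
      σ = [-1]^ length xs
      P = prodL xs (inv ∘ f)

    -- The vanishing factor has the value inv 0 = 1 before and after negation, so only length minus
    -- one signs appear; `suc (length xs)` has the same parity and avoids subtraction.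
    prod-inv-neg₁ : ∀ {xs} → OneZero f xs →
                    prodL xs (inv ∘ -_ ∘ f) ≈ [-1]^ suc (length xs) * prodL xs (inv ∘ f)
    prod-inv-neg₁ {x ∷ xs} (here p ps) = begin
      inv (- f x) * prodL xs (inv ∘ -_ ∘ f)  ≈⟨ *-cong (inv-zero (trans (-‿cong p) -0#≈0#)) (prod-inv-neg ps) ⟩
      1# * (σ * P)                           ≈⟨ solve 3 (λ i s p → i :* (s :* p) := s :* (i :* p)) refl _ _ _ ⟩
      σ * (1# * P)                           ≈⟨ *-cong (-‿involutive σ) (*-congʳ (inv-zero p)) ⟨
      - - σ * (inv (f x) * P)                ∎
      where
      σ = [-1]^ length xs
      P = prodL xs (inv ∘ f)
    prod-inv-neg₁ {x ∷ xs} (there p ps) = begin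
      inv (- f x) * prodL xs (inv ∘ -_ ∘ f)  ≈⟨ *-cong (inv-neg p) (prod-inv-neg₁ ps) ⟩
      - inv (f x) * (σ * P)                  ≈⟨ -‿distribˡ-* _ _ ⟨
      - (inv (f x) * (σ * P))                ≈⟨ -‿cong (solve 3 (λ i s p → i :* (s :* p) := s :* (i :* p)) refl _ _ _) ⟩
      - (σ * (inv (f x) * P))                ≈⟨ -‿distribˡ-* _ _ ⟩
      - σ * (inv (f x) * P)                  ∎
      where
      σ = [-1]^ suc (length xs)
      P = prodL xs (inv ∘ f)

  -- Negation permutes the elements, and only 0 escapes the change of sign.
  [-1]^[1+order] : [-1]^ suc order ≈ 1#
  [-1]^[1+order] = *-cancel W≉0 (begin
    W * [-1]^ suc order                ≈⟨ *-comm _ _ ⟩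
    [-1]^ suc order * W                ≈⟨ prod-inv-neg₁ {f = id} (one distinct (complete 0#)) ⟨
    prodL elements (inv ∘ -_)          ≡⟨ prodL-map -_ elements ⟨
    prodL (map -_ elements) inv        ≈⟨ full-product (UniqueSP.map⁺ setoid setoid -‿injective distinct) (List.length-map -_ elements) ⟩
    W                                  ≈⟨ *-identityʳ W ⟨
    W * 1#                             ∎)
    where
    W = prodL elements inv
    W≉0 : W ≉ 0#
    W≉0 = prodL≉0 elements inv≉0
    one : ∀ {xs} → Uniqueˢ xs → 0# ∈ˢ xs → OneZero id xs
    one (x∉ ∷ _) (here p)  = here (sym p) (All.map (λ x≉y y≈0 → x≉y (trans (sym p) (sym y≈0))) x∉)
    one (x∉ ∷ u) (there q) =
      there (λ x≈0 → All.All¬⇒¬Any x∉ (MemberSP.∈-resp-≈ setoid (sym x≈0) q)) (one u q)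

-- The vanishing sum in a plane over the finite field

module _ (F : FiniteField) where
  open FiniteField F hiding (zero)
  open Field F
  open LinAlg F using (sumL)
  open UniqueS setoid using () renaming (Unique to Uniqueˢ)

  -- The quotient by the span of A is never formed. `D` is its area form pulled back to V;
  -- `D-plücker` expresses that this form has rank at most two and `D-pencil` supplies linear
  -- combinations, so `V` can be a bare set.
  module Plane {V : Set} (D : V → V → Carrier)
    (D-alt     : ∀ x → D x x ≈ 0#)
    (D-anti    : ∀ x y → D x y ≈ - D y x)
    (D-plücker : ∀ a b s t → D a b * D s t + D s b * D t a ≈ D s a * D t b)
    (D-pencil  : ∀ a b c → ∃ λ w → ∀ x → D w x ≈ D a x + c * D b x)
    where

    Indep : V → V → Set
    Indep x y = D x y ≉ 0#

    Indep-sym : ∀ {x y} → Indep x y → Indep y x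
    Indep-sym {x} {y} x≉ y≈ = x≉ (trans (D-anti x y) (trans (-‿cong y≈) -0#≈0#))

    AllPairs-resp-↭ : ∀ {I J} → I ↭ J → AllPairs Indep I → AllPairs Indep J
    AllPairs-resp-↭ p = PermSP.AllPairs-resp-↭ (≡.setoid V) Indep-sym
      ((λ { ≡.refl → id }) , (λ { ≡.refl → id })) (Perm.↭⇒↭ₛ p)

    -- For x in I the factor of x itself is inv (D x x) = inv 0 = 1, so this is the product over the
    -- other vectors without any deletion from the list.
    weight : List V → V → Carrier
    weight I x = prodL I λ s → inv (D s x)

    -- The slope of s on the projective line of directions. The vector a has slope 0 and b lies at
    -- infinity, so the lists of slopes add 0 for a and omit b.
    ratio : V → V → V → Carrier
    ratio a b s = D s a * inv (D s b)

    ratio-* : ∀ {a b s} → Indep b s → ratio a b s * D s b ≈ D s a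
    ratio-* {a} {b} {s} b≁s = begin
      (D s a * inv (D s b)) * D s b  ≈⟨ solve 3 (λ x i y → (x :* i) :* y := x :* (y :* i)) refl _ _ _ ⟩
      D s a * (D s b * inv (D s b))  ≈⟨ *-congˡ (inv-inverse (Indep-sym b≁s)) ⟩
      D s a * 1#                     ≈⟨ *-identityʳ _ ⟩
      D s a                          ∎

    ratio≉0 : ∀ {a b s} → Indep a s → ratio a b s ≉ 0#
    ratio≉0 a≁s = *-nonzero (Indep-sym a≁s) (inv≉0 _)

    -- Equal slopes give D s a * D t b = D s b * D t a, and the Plücker relation then leaves D a b *
    -- D s t = 0, a product of nonzero factors.
    ratio-injective : ∀ {a b s t} → Indep a b → Indep b s → Indep b t → Indep s t →
                      ratio a b s ≉ ratio a b t
    ratio-injective {a} {b} {s} {t} a≁b b≁s b≁t s≁t eq =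
      *-nonzero a≁b s≁t (+-cancelʳ (D s b * D t a) _ _ (begin
        D a b * D s t + D s b * D t a    ≈⟨ D-plücker a b s t ⟩
        D s a * D t b                    ≈⟨ *-congʳ (ratio-* b≁s) ⟨
        (ratio a b s * D s b) * D t b    ≈⟨ *-congʳ (*-congʳ eq) ⟩
        (ratio a b t * D s b) * D t b    ≈⟨ solve 3 (λ r x y → (r :* x) :* y := x :* (r :* y)) refl _ _ _ ⟩
        D s b * (ratio a b t * D t b)    ≈⟨ *-congˡ (ratio-* b≁t) ⟩
        D s b * D t a                    ≈⟨ +-identityˡ _ ⟨
        0# + D s b * D t a               ∎))

    ratios-unique : ∀ {a b J} → AllPairs Indep (a ∷ b ∷ J) → Uniqueˢ (0# ∷ map (ratio a b) J)
    ratios-unique {a} {b} ((a≁b ∷ a≁) ∷ b≁ ∷ J≁) =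
      All.map⁺ (All.map (λ a≁s 0≈ρ → ratio≉0 a≁s (sym 0≈ρ)) a≁) ∷ go b≁ J≁
      where
      go : ∀ {J} → All (Indep b) J → AllPairs Indep J → Uniqueˢ (map (ratio a b) J)
      go []        []        = []
      go (p ∷ ps)  (q ∷ qs)  =
        All.map⁺ (All.zipWith (λ (b≁t , s≁t) → ratio-injective a≁b p b≁t s≁t) (ps , q)) ∷ go ps qs

    -- Slope 0 of a and the slopes of J are distinct field elements; with b at infinity this bounds
    -- pairwise independent families by q + 1.
    indep-length : ∀ {a b J} → AllPairs Indep (a ∷ b ∷ J) → suc (length J) ≤ order
    indep-length {a} {b} {J} ≁ =
      ≡.subst (λ l → suc l ≤ order) (List.length-map (ratio a b) J) (unique-length-≤ (ratios-unique ≁))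

    -- For w = a - c b, the value D w s vanishes exactly when c is the slope of s, so c is chosen
    -- off the slopes in use; c ≉ 0 makes w independent of a, and D w b = D a b makes it independent
    -- of b.
    extend : ∀ {a b J} → AllPairs Indep (a ∷ b ∷ J) → suc (length J) < order →
             ∃ λ w → (∃ λ c → ∀ x → D w x ≈ D a x + c * D b x) × All (Indep w) (a ∷ b ∷ J)
    extend {a} {b} {J} ≁@((a≁b ∷ a≁) ∷ b≁ ∷ J≁) lt
      with fresh (ratios-unique ≁) (≡.subst (λ l → suc l < order) (≡.sym (List.length-map (ratio a b) J)) lt)
    ... | c , (c≉0 ∷ c≉ρ) with D-pencil a b (- c)
    ...   | w , w≈ = w , (- c , w≈) , w≁a ∷ w≁b ∷ All.zipWith w≁ (b≁ , All.map⁻ c≉ρ)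
      where
      w≁a : Indep w a
      w≁a w≈0 = *-nonzero (-‿nonzero c≉0) (Indep-sym a≁b) (begin
        - c * D b a          ≈⟨ +-identityˡ _ ⟨
        0# + - c * D b a     ≈⟨ +-congʳ (D-alt a) ⟨
        D a a + - c * D b a  ≈⟨ w≈ a ⟨
        D w a                ≈⟨ w≈0 ⟩
        0#                   ∎)
      w≁b : Indep w b
      w≁b w≈0 = a≁b (begin
        D a b                ≈⟨ +-identityʳ _ ⟨
        D a b + 0#           ≈⟨ +-congˡ (zeroʳ (- c)) ⟨
        D a b + - c * 0#     ≈⟨ +-congˡ (*-congˡ (D-alt b)) ⟨
        D a b + - c * D b b  ≈⟨ w≈ b ⟨
        D w b                ≈⟨ w≈0 ⟩
        0#                   ∎)
      w≁ : ∀ {s} → Indep b s × c ≉ ratio a b s → Indep w s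
      w≁ {s} (b≁s , c≉) w≈0 = c≉ (*-cancel (Indep-sym b≁s) (begin
        D s b * c            ≈⟨ *-comm _ _ ⟩
        c * D s b            ≈⟨ -x*-y≈x*y c (D s b) ⟨
        - c * - D s b        ≈⟨ *-congˡ (D-anti b s) ⟨
        - c * D b s          ≈⟨ +-inverseʳ-unique _ _ (trans (sym (w≈ s)) w≈0) ⟩
        - D a s              ≈⟨ D-anti s a ⟨
        D s a                ≈⟨ ratio-* b≁s ⟨
        ratio a b s * D s b  ≈⟨ *-comm _ _ ⟩
        D s b * ratio a b s  ∎))

    -- Every nonzero element enters inverted once, 0 enters as inv 0 = 1, and the minus sign is that
    -- of D b a = - D a b.
    κ : Carrier
    κ = - prodL elements inv

    -- The ratios together with 0 exhaust the field.
    weight-full-κ : ∀ {a b J} → AllPairs Indep (a ∷ b ∷ J) → suc (length J) ≡ order →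
                    weight (a ∷ b ∷ J) a ≈ κ * weight (a ∷ b ∷ J) b
    weight-full-κ {a} {b} {J} ≁@((a≁b ∷ a≁) ∷ b≁ ∷ J≁) eq = begin
      inv (D a a) * (inv (D b a) * weight J a)  ≈⟨ *-cong (inv-zero (D-alt a)) (*-cong (trans (inv-cong (D-anti b a)) (inv-neg a≁b)) Ja≈) ⟩
      1# * (- inv (D a b) * (W * weight J b))   ≈⟨ solve 4 (λ o i w j → o :* (i :* (w :* j)) := (w :* i) :* (o :* j)) refl _ _ _ _ ⟩
      (W * - inv (D a b)) * (1# * weight J b)   ≈⟨ *-congʳ (trans (sym (-‿distribʳ-* _ _)) (-‿distribˡ-* _ _)) ⟩
      (- W * inv (D a b)) * (1# * weight J b)   ≈⟨ *-assoc _ _ _ ⟩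
      - W * (inv (D a b) * (1# * weight J b))   ≈⟨ *-congˡ (*-congˡ (*-congʳ (inv-zero (D-alt b)))) ⟨
      - W * (inv (D a b) * (inv (D b b) * weight J b)) ∎
      where
      W = prodL elements inv
      inv-split : ∀ {s} → Indep a s × Indep b s → inv (D s a) ≈ inv (ratio a b s) * inv (D s b)
      inv-split {s} (a≁s , b≁s) = inv-unique (begin
        D s a * (inv (ratio a b s) * inv (D s b))                    ≈⟨ *-congʳ (ratio-* b≁s) ⟨
        (ratio a b s * D s b) * (inv (ratio a b s) * inv (D s b))    ≈⟨ solve 4 (λ r d i j → (r :* d) :* (i :* j) := (r :* i) :* (d :* j)) refl _ _ _ _ ⟩
        (ratio a b s * inv (ratio a b s)) * (D s b * inv (D s b))    ≈⟨ *-cong (inv-inverse (ratio≉0 a≁s)) (inv-inverse (Indep-sym b≁s)) ⟩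
        1# * 1#                                                      ≈⟨ *-identityˡ 1# ⟩
        1#                                                           ∎)
      Ja≈ : weight J a ≈ W * weight J b
      Ja≈ = begin
        weight J a                                              ≈⟨ prodL-cong J (All.zipWith inv-split (a≁ , b≁)) ⟩
        prodL J (λ s → inv (ratio a b s) * inv (D s b))         ≈⟨ prodL-* J _ _ ⟩
        prodL J (inv ∘ ratio a b) * weight J b                  ≡⟨ ≡.cong (_* weight J b) (prodL-map (ratio a b) J) ⟨
        prodL (map (ratio a b) J) inv * weight J b              ≈⟨ *-congʳ (*-identityˡ _) ⟨
        (1# * prodL (map (ratio a b) J) inv) * weight J b       ≈⟨ *-congʳ (*-congʳ (inv-zero refl)) ⟨
        prodL (0# ∷ map (ratio a b) J) inv * weight J b         ≈⟨ *-congʳ (full-product (ratios-unique ≁) (≡.trans (≡.cong suc (List.length-map (ratio a b) J)) eq)) ⟩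
        W * weight J b                                          ∎

    -- Ensures that q + 1 vectors include a third one besides a and b, with which `weight-full`
    -- compares them.
    1<order : 1 < order
    1<order = unique-length-≤ {0# ∷ 1# ∷ []} (((λ 0≈1 → 1≉0 (sym 0≈1)) ∷ []) ∷ [] ∷ [])

    -- Comparing a and b with a third vector of I eliminates κ (and so gives Wilson's theorem).
    weight-full : ∀ {a b J I} → I ↭ a ∷ b ∷ J → AllPairs Indep I → length I ≡ suc order →
                  weight I a ≈ weight I b
    weight-full {a} {b} {[]} p ≁ eq =
      contradiction (ℕ.suc-injective (≡.trans (≡.sym (PermP.↭-length p)) eq)) (ℕ.<⇒≢ 1<order)
    weight-full {a} {b} {c ∷ J} {I} p ≁ eq = *-cancel (-‿nonzero (prodL≉0 elements inv≉0)) (begin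
      κ * weight I a ≈⟨ via a (b ∷ J) (Perm.trans p (PermP.shift c (a ∷ b ∷ []) J)) ⟨
      weight I c     ≈⟨ via b (a ∷ J) (Perm.trans p (Perm.trans (PermP.shift c (a ∷ b ∷ []) J) (prep c (swap a b Perm.refl)))) ⟩
      κ * weight I b ∎)
      where
      via : ∀ x J → I ↭ c ∷ x ∷ J → weight I c ≈ κ * weight I x
      via x J q = begin
        weight I c                 ≈⟨ prodL-↭ q ⟩
        weight (c ∷ x ∷ J) c       ≈⟨ weight-full-κ (AllPairs-resp-↭ q ≁) (ℕ.suc-injective (≡.trans (≡.sym (PermP.↭-length q)) eq)) ⟩
        κ * weight (c ∷ x ∷ J) x   ≈⟨ *-congˡ (prodL-↭ q) ⟨
        κ * weight I x             ∎

    weight-cancel : ∀ {w x} I → Indep w x → D w x * weight (w ∷ I) x ≈ weight I x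
    weight-cancel {w} {x} I w≁x = begin
      D w x * (inv (D w x) * weight I x)  ≈⟨ *-assoc _ _ _ ⟨
      (D w x * inv (D w x)) * weight I x  ≈⟨ *-congʳ (inv-inverse w≁x) ⟩
      1# * weight I x                     ≈⟨ *-identityˡ _ ⟩
      weight I x                          ∎

    Φ : List V → List V → Carrier
    Φ I E = sumL E λ x → weight I x * weight E x

    -- The factor D a x kills the term x = a and cancels inv (D a x) in every other term, which
    -- amounts to deleting a from the list.
    Φ-head : ∀ {a E} I → All (Indep a) E →
             sumL (a ∷ E) (λ x → weight I x * (D a x * weight (a ∷ E) x)) ≈ Φ I E
    Φ-head {a} {E} I a≁ = begin
      weight I a * (D a a * weight (a ∷ E) a) + _  ≈⟨ +-cong (trans (*-congˡ (trans (*-congʳ (D-alt a)) (zeroˡ _))) (zeroʳ _))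
                                                            (sumL-cong E (All.map (λ a≁x → *-congˡ (weight-cancel E a≁x)) a≁)) ⟩
      0# + Φ I E                                   ≈⟨ +-identityˡ _ ⟩
      Φ I E                                        ∎

    Φ-↭ : ∀ {E E′} (g : V → Carrier) I → E ↭ E′ →
          sumL E (λ x → weight I x * (g x * weight E x)) ≈ sumL E′ (λ x → weight I x * (g x * weight E′ x))
    Φ-↭ {E} g I p = trans (sumL-cong E (All.universal (λ x → *-congˡ (*-congˡ (prodL-↭ p))) E)) (sumL-↭ p)

    -- Removing a or b from E while adding w = a + c b to I: since D w = D a + c D b,
    -- the identity for (I , E) is a combination of those for the two smaller E.
    Φ-vanishes : ∀ E J {a b I} → I ↭ a ∷ b ∷ E ++ J → AllPairs Indep I →
                 length E ℕ.+ length I ≡ suc order → Φ I (a ∷ b ∷ E) ≈ 0#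
    Φ-vanishes [] J {a} {b} {I} p ≁ eq with AllPairs-resp-↭ p ≁
    ... | (a≁b ∷ _) ∷ _ = begin
      weight I a * (inv (D a a) * (inv (D b a) * 1#)) + (weight I b * (inv (D a b) * (inv (D b b) * 1#)) + 0#)
        ≈⟨ +-cong (*-congˡ (trans (*-congʳ (inv-zero (D-alt a))) (*-identityˡ _)))
                  (trans (+-identityʳ _) (*-congˡ (*-congˡ (trans (*-congʳ (inv-zero (D-alt b))) (*-identityˡ 1#))))) ⟩
      weight I a * (inv (D b a) * 1#) + weight I b * (inv (D a b) * 1#)
        ≈⟨ +-cong (*-cong (weight-full p ≁ eq) (trans (*-identityʳ _) (trans (inv-cong (D-anti b a)) (inv-neg a≁b)))) (*-congˡ (*-identityʳ _)) ⟩
      weight I b * - inv (D a b) + weight I b * inv (D a b)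
        ≈⟨ distribˡ _ _ _ ⟨
      weight I b * (- inv (D a b) + inv (D a b))
        ≈⟨ *-congˡ (-‿inverseˡ _) ⟩
      weight I b * 0#
        ≈⟨ zeroʳ _ ⟩
      0# ∎
    Φ-vanishes (e ∷ E) J {a} {b} {I} p ≁ eq with AllPairs-resp-↭ p ≁
    ... | ≁L@((a≁b ∷ a≁) ∷ b≁ ∷ _) with extend ≁L lt
      where
      lt : suc (length (e ∷ E ++ J)) < order
      -- With at least three vectors in the second list |I| ≤ q, so 0 and the slopes of the vectors
      -- of I other than a and b leave an element of the field free.
      lt = ℕ.≤-trans (ℕ.m≤n+m _ (length E)) (ℕ.≤-reflexive (ℕ.suc-injective
        (≡.trans (≡.cong (λ l → suc (length E ℕ.+ l)) (≡.sym (PermP.↭-length p))) eq)))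
    ...   | w , (c , w≈) , w≁L = begin
      Φ I L
        ≈⟨ sumL-cong L (All.map split (All.++⁻ˡ L w≁L)) ⟩
      sumL L (λ x → weight I′ x * (D a x * weight L x) + c * (weight I′ x * (D b x * weight L x)))
        ≈⟨ sumL-+ L _ _ ⟩
      sumL L (λ x → weight I′ x * (D a x * weight L x)) + sumL L (λ x → c * (weight I′ x * (D b x * weight L x)))
        ≈⟨ +-cong (Φ-head I′ (a≁b ∷ All.++⁻ˡ (e ∷ E) a≁)) (sumL-scale L c _) ⟩
      Φ I′ (b ∷ e ∷ E) + c * sumL L (λ x → weight I′ x * (D b x * weight L x))
        ≈⟨ +-congˡ (*-congˡ (trans (Φ-↭ {L} {b ∷ a ∷ e ∷ E} (D b) I′ (swap a b Perm.refl)) (Φ-head I′ (Indep-sym a≁b ∷ All.++⁻ˡ (e ∷ E) b≁)))) ⟩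
      Φ I′ (b ∷ e ∷ E) + c * Φ I′ (a ∷ e ∷ E)
        ≈⟨ +-cong (Φ-vanishes E (w ∷ a ∷ J) (move b a p) ≁′ eq′)
                  (*-congˡ (Φ-vanishes E (w ∷ b ∷ J) (move a b (Perm.trans p (swap a b Perm.refl))) ≁′ eq′)) ⟩
      0# + c * 0#
        ≈⟨ trans (+-identityˡ _) (zeroʳ c) ⟩
      0# ∎
      where
      L  = a ∷ b ∷ e ∷ E
      I′ = w ∷ I
      ≁′ : AllPairs Indep I′
      ≁′ = PermP.All-resp-↭ (Perm.↭-sym p) w≁L ∷ ≁
      eq′ : length E ℕ.+ length I′ ≡ suc order
      eq′ = ≡.trans (ℕ.+-suc _ _) eq
      -- The vector y leaves the second list but remains in I′, so it joins the remainder J together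
      -- with w.
      move : ∀ x y → I ↭ y ∷ x ∷ e ∷ E ++ J → I′ ↭ x ∷ e ∷ E ++ (w ∷ y ∷ J)
      move x y q = Perm.trans (prep w (Perm.trans q (Perm.↭-sym (PermP.shift y (x ∷ e ∷ E) J))))
                              (Perm.↭-sym (PermP.shift w (x ∷ e ∷ E) (y ∷ J)))
      split : ∀ {x} → Indep w x → weight I x * weight L x ≈
              weight I′ x * (D a x * weight L x) + c * (weight I′ x * (D b x * weight L x))
      split {x} w≁x = begin
        weight I x * weight L x                              ≈⟨ *-congʳ (weight-cancel I w≁x) ⟨
        (D w x * weight I′ x) * weight L x                   ≈⟨ *-congʳ (*-congʳ (w≈ x)) ⟩
        ((D a x + c * D b x) * weight I′ x) * weight L x
          ≈⟨ solve 5 (λ a c b i l → ((a :+ c :* b) :* i) :* l := i :* (a :* l) :+ c :* (i :* (b :* l))) refl _ _ _ _ _ ⟩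
        weight I′ x * (D a x * weight L x) + c * (weight I′ x * (D b x * weight L x)) ∎

    one-zero : ∀ {L x} → AllPairs Indep L → x ∈ₗ L → OneZero (λ s → D s x) L
    one-zero {x = x} (x≁ ∷ _) (here ≡.refl) = here (D-alt x) (All.map Indep-sym x≁)
    one-zero (y≁ ∷ ≁)         (there x∈)    = there (All.lookup y≁ x∈) (one-zero ≁ x∈)

    -- Of the |I| + |E| = q + 3 factors all but two change sign with D.
    weight-sign : ∀ {I E x} l → AllPairs Indep I → AllPairs Indep E → x ∈ₗ I → x ∈ₗ E →
                  length I ℕ.+ length E ≡ 3 ℕ.+ order →
                  prodL I (λ s → inv ([-1]^ l * D s x)) * prodL E (λ s → inv ([-1]^ l * D s x))
                    ≈ weight I x * weight E x
    weight-sign {I} {E} {x} l ≁I ≁E x∈I x∈E eq with [-1]^-cases l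
    ... | inj₁ σ≈1 = *-cong (prodL-cong I (All.universal strip I)) (prodL-cong E (All.universal strip E))
      where
      strip : ∀ s → inv ([-1]^ l * D s x) ≈ inv (D s x)
      strip s = inv-cong (trans (*-congʳ σ≈1) (*-identityˡ _))
    ... | inj₂ σ≈-1 = begin
      prodL I (λ s → inv ([-1]^ l * D s x)) * prodL E (λ s → inv ([-1]^ l * D s x))
        ≈⟨ *-cong (prodL-cong I (All.universal strip I)) (prodL-cong E (All.universal strip E)) ⟩
      prodL I (λ s → inv (- D s x)) * prodL E (λ s → inv (- D s x))
        ≈⟨ *-cong (prod-inv-neg₁ (one-zero ≁I x∈I)) (prod-inv-neg₁ (one-zero ≁E x∈E)) ⟩
      ([-1]^ suc (length I) * weight I x) * ([-1]^ suc (length E) * weight E x)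
        ≈⟨ solve 4 (λ s i t e → (s :* i) :* (t :* e) := (s :* t) :* (i :* e)) refl _ _ _ _ ⟩
      ([-1]^ suc (length I) * [-1]^ suc (length E)) * (weight I x * weight E x)
        ≈⟨ *-congʳ total ⟩
      1# * (weight I x * weight E x)
        ≈⟨ *-identityˡ _ ⟩
      weight I x * weight E x ∎
      where
      strip : ∀ s → inv ([-1]^ l * D s x) ≈ inv (- D s x)
      strip s = inv-cong (trans (*-congʳ σ≈-1) (-1*x≈-x _))
      -- The exponents add up to q + 5, that is q + 1 and four further signs that cancel.
      total : [-1]^ suc (length I) * [-1]^ suc (length E) ≈ 1#
      total = begin
        [-1]^ suc (length I) * [-1]^ suc (length E)   ≈⟨ [-1]^-+ (suc (length I)) (suc (length E)) ⟨
        [-1]^ (suc (length I) ℕ.+ suc (length E))     ≡⟨ ≡.cong ([-1]^_ ∘ suc) (≡.trans (ℕ.+-suc (length I) (length E)) (≡.cong suc eq)) ⟩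
        - - - - ([-1]^ suc order)                     ≈⟨ trans (-‿involutive _) (-‿involutive _) ⟩
        [-1]^ suc order                               ≈⟨ [-1]^[1+order] ⟩
        1#                                            ∎

-- Inserting one entry into a vector, and the position that decides the sign

data Insert {A : Set} (x : A) : ∀ {n} → Vec A n → Vec A (suc n) → Set where
  here  : ∀ {n} {v : Vec A n} → Insert x v (x ∷ v)
  there : ∀ {n y} {v : Vec A n} {w} → Insert x v w → Insert x (y ∷ v) (y ∷ w)

depth : ∀ {A : Set} {x : A} {n} {v : Vec A n} {w} → Insert x v w → ℕ
depth here      = zero
depth (there p) = suc (depth p)

Insert-map : ∀ {A B : Set} (f : A → B) {x n} {v : Vec A n} {w} →
             Insert x v w → Insert (f x) (Vec.map f v) (Vec.map f w)
Insert-map f here      = here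
Insert-map f (there p) = there (Insert-map f p)

Insert-∈ : ∀ {A : Set} {x y : A} {n} {v : Vec A n} {w} → Insert x v w → y ∈ᵥ w → y ∈ᵥ v ⊎ y ≡ x
Insert-∈ here      (hereᵥ y≡x)  = inj₂ y≡x
Insert-∈ here      (thereᵥ y∈)  = inj₁ y∈
Insert-∈ (there p) (hereᵥ y≡z)  = inj₁ (hereᵥ y≡z)
Insert-∈ (there p) (thereᵥ y∈) with Insert-∈ p y∈
... | inj₁ y∈v = inj₁ (thereᵥ y∈v)
... | inj₂ y≡x = inj₂ y≡x

remove : ∀ {A : Set} {x : A} {n} {w : Vec A (suc n)} → x ∈ᵥ w → ∃ λ v → Insert x v w
remove {w = y ∷ w}     (hereᵥ ≡.refl) = w , here
remove {w = y ∷ z ∷ w} (thereᵥ x∈) with remove x∈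
... | v , p = y ∷ v , there p

-- Alternating multilinear forms and the determinant in coordinates

module Multilinear (F : FiniteField) where
  open FiniteField F hiding (zero)
  open Field F
  open LinAlg F

  sumF-cong : ∀ n {f g : Fin n → Carrier} → (∀ i → f i ≈ g i) → sumF f ≈ sumF g
  sumF-cong zero    p = refl
  sumF-cong (suc n) p = +-cong (p zero) (sumF-cong n (p ∘ suc))

  sumF-zero : ∀ n {f : Fin n → Carrier} → (∀ i → f i ≈ 0#) → sumF f ≈ 0#
  sumF-zero zero    p = refl
  sumF-zero (suc n) p = trans (+-cong (p zero) (sumF-zero n (p ∘ suc))) (+-identityˡ 0#)

  sumF-+ : ∀ n (f g : Fin n → Carrier) → sumF (λ i → f i + g i) ≈ sumF f + sumF g
  sumF-+ zero    f g = sym (+-identityˡ 0#)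
  sumF-+ (suc n) f g = trans (+-congˡ (sumF-+ n (f ∘ suc) (g ∘ suc)))
    (solve 4 (λ a b c d → (a :+ b) :+ (c :+ d) := (a :+ c) :+ (b :+ d)) refl _ _ _ _)

  sumF-scale : ∀ n a (f : Fin n → Carrier) → sumF (λ i → a * f i) ≈ a * sumF f
  sumF-scale zero    a f = sym (zeroʳ a)
  sumF-scale (suc n) a f = trans (+-congˡ (sumF-scale n a (f ∘ suc))) (sym (distribˡ a _ _))

  sumF-neg : ∀ n (f : Fin n → Carrier) → sumF (λ i → - f i) ≈ - sumF f
  sumF-neg zero    f = sym -0#≈0#
  sumF-neg (suc n) f = trans (+-congˡ (sumF-neg n (f ∘ suc))) (-‿+-comm _ _)

  sumF-swap : ∀ m n (f : Fin m → Fin n → Carrier) →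
              sumF (λ i → sumF (f i)) ≈ sumF (λ j → sumF (λ i → f i j))
  sumF-swap zero    n f = sym (sumF-zero n λ _ → refl)
  sumF-swap (suc m) n f = trans (+-congˡ (sumF-swap m n (f ∘ suc))) (sym (sumF-+ n (f zero) _))

  δ : ∀ {n} → Fin n → Fin n → Carrier
  δ zero    zero    = 1#
  δ zero    (suc j) = 0#
  δ (suc i) zero    = 0#
  δ (suc i) (suc j) = δ i j

  δ-sum : ∀ {n} (i : Fin n) (f : Fin n → Carrier) → sumF (λ j → δ i j * f j) ≈ f i
  δ-sum {suc n} zero f = trans (+-cong (*-identityˡ _) (sumF-zero n λ j → zeroˡ _)) (+-identityʳ _)
  δ-sum {suc n} (suc i) f = trans (+-cong (zeroˡ _) (δ-sum i (f ∘ suc))) (+-identityˡ _)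

  det-cong : ∀ {n} {M N : Fin n → Fin n → Carrier} → (∀ i j → M i j ≈ N i j) → det M ≈ det N
  det-cong {zero}  p = refl
  det-cong {suc n} p = sumF-cong (suc n) λ j → *-congˡ {x = sign j} (*-cong (p zero j) (det-cong λ r c → p (suc r) (punchIn j c)))

  det-δ : ∀ n → det (δ {n}) ≈ 1#
  det-δ zero    = refl
  det-δ (suc n) = begin
    1# * (1# * det (δ {n})) + _  ≈⟨ +-cong (trans (*-identityˡ _) (trans (*-identityˡ _) (det-δ n)))
                                           (sumF-zero n λ j → trans (*-congˡ {x = - sign j} (zeroˡ _)) (zeroʳ _)) ⟩
    1# + 0#                      ≈⟨ +-identityʳ _ ⟩
    1#                           ∎

  private
    lift : ∀ {m n} → (Fin m → Fin n) → Fin (suc m) → Fin (suc n)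
    lift f zero    = zero
    lift f (suc i) = suc (f i)

  -- Expanding along two equal rows: the terms deleting columns {j , j′} cancel in pairs.
  alternating-sum : ∀ n (x : Fin (2 ℕ.+ n) → Carrier) (K : (Fin n → Fin (2 ℕ.+ n)) → Carrier) →
    (∀ {f g} → f ≗ g → K f ≈ K g) →
    sumF (λ j → sign j * (x j * sumF λ c → sign c * (x (punchIn j c) * K (punchIn j ∘ punchIn c)))) ≈ 0#
  alternating-sum n x K K-cong = begin
    1# * (x zero * sumF (λ c → sign c * (x (suc c) * K (suc ∘ punchIn c)))) + sumF L
      ≈⟨ +-cong head (sumF-cong (suc n) tail) ⟩
    sumF T + sumF (λ j → - T j + sign j * (x (suc j) * R j))
      ≈⟨ +-congˡ (trans (sumF-+ (suc n) (λ j → - T j) (λ j → sign j * (x (suc j) * R j))) (+-cong (sumF-neg (suc n) T) (R-zero n x K K-cong))) ⟩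
    sumF T + (- sumF T + 0#)
      ≈⟨ +-congˡ (+-identityʳ _) ⟩
    sumF T + - sumF T
      ≈⟨ -‿inverseʳ _ ⟩
    0# ∎
    where
    -- `T` holds the terms deleting column 0 and one other. Each occurs twice with opposite signs,
    -- as column 0 is taken once by the first row and once by the second.
    T : Fin (suc n) → Carrier
    T j = sign j * (x zero * (x (suc j) * K (suc ∘ punchIn j)))
    R : Fin (suc n) → Carrier
    R j = sumF λ c → sign c * (x (suc (punchIn j c)) * K (punchIn (suc j) ∘ punchIn (suc c)))
    L : Fin (suc n) → Carrier
    L j = - sign j * (x (suc j) * (1# * (x zero * K (suc ∘ punchIn j)) +
            sumF (λ c → - sign c * (x (suc (punchIn j c)) * K (punchIn (suc j) ∘ punchIn (suc c))))))
    head : 1# * (x zero * sumF (λ c → sign c * (x (suc c) * K (suc ∘ punchIn c)))) ≈ sumF T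
    head = trans (*-identityˡ _) (trans (sym (sumF-scale (suc n) (x zero) (λ c → sign c * (x (suc c) * K (suc ∘ punchIn c)))))
      (sumF-cong (suc n) λ c → solve 4 (λ a s b k → a :* (s :* (b :* k)) := s :* (a :* (b :* k))) refl (x zero) (sign c) (x (suc c)) (K (suc ∘ punchIn c))))
    tail : ∀ j → L j ≈ - T j + sign j * (x (suc j) * R j)
    tail j = begin
      - s * (y * (1# * (x zero * k) + sumF (λ c → - sign c * r c)))
        ≈⟨ *-congˡ (*-congˡ (+-cong (*-identityˡ _) (trans (sumF-cong n λ c → sym (-‿distribˡ-* (sign c) (r c))) (sumF-neg n _)))) ⟩
      - s * (y * (x zero * k + - R j))
        ≈⟨ solve 5 (λ s y z k r → s :* (y :* (z :* k :+ r)) := s :* (z :* (y :* k)) :+ s :* (y :* r)) refl _ _ _ _ _ ⟩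
      - s * (x zero * (y * k)) + - s * (y * - R j)
        ≈⟨ +-cong (sym (-‿distribˡ-* _ _)) (trans (*-congˡ (sym (-‿distribʳ-* _ _))) (-x*-y≈x*y _ _)) ⟩
      - T j + s * (y * R j) ∎
      where
      s = sign j
      y = x (suc j)
      k = K (suc ∘ punchIn j)
      r = λ c → x (suc (punchIn j c)) * K (punchIn (suc j) ∘ punchIn (suc c))
    R-zero : ∀ n (x : Fin (2 ℕ.+ n) → Carrier) (K : (Fin n → Fin (2 ℕ.+ n)) → Carrier) →
      (∀ {f g} → f ≗ g → K f ≈ K g) →
      sumF (λ j → sign j * (x (suc j) * sumF λ c → sign c * (x (suc (punchIn j c)) * K (punchIn (suc j) ∘ punchIn (suc c))))) ≈ 0#
    R-zero zero    x K K-cong = sumF-zero 1 λ j → trans (*-congˡ {x = sign j} (zeroʳ (x (suc j)))) (zeroʳ (sign j))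
    R-zero (suc n) x K K-cong = trans
      (sumF-cong (2 ℕ.+ n) λ j → *-congˡ {x = sign j} (*-congˡ {x = x (suc j)}
        (sumF-cong (suc n) λ c → *-congˡ {x = sign c} (*-congˡ {x = x (suc (punchIn j c))}
          (K-cong {punchIn (suc j) ∘ punchIn (suc c)} {lift (punchIn j ∘ punchIn c)}
            λ { zero → ≡.refl ; (suc i) → ≡.refl })))))
      -- Neither deletion touches column 0, so the rest is the same sum over the later columns;
      -- `lift` keeps column 0 in front of each minor.
      (alternating-sum n (x ∘ suc) (K ∘ lift)
        λ f≗g → K-cong λ { zero → ≡.refl ; (suc i) → ≡.cong suc (f≗g i) })

  module _ {k : ℕ} where

    private
      V : Set
      V = Vect k

    -- The separate w with a pointwise equation builds congruence into linearity: a function on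
    -- `Vect k` need not respect pointwise `_≈_` by itself.
    Linear : (V → Carrier) → Set
    Linear g = ∀ {j} (c : Fin j → Carrier) (v : Fin j → V) w → (∀ t → lincomb c v t ≈ w t) →
               g w ≈ sumF λ i → c i * g (v i)

    _⊕_·_ : V → Carrier → V → V
    (v ⊕ a · w) t = v t + a * w t

    linear-cong : ∀ {g} → Linear g → ∀ {v w} → (∀ t → v t ≈ w t) → g v ≈ g w
    linear-cong {g} lin {v} {w} v≈w = begin
      g v             ≈⟨ trans (+-identityʳ _) (*-identityˡ _) ⟨
      1# * g v + 0#   ≈⟨ lin {1} (λ _ → 1#) (λ _ → v) w (λ t → trans (+-identityʳ _) (trans (*-identityˡ _) (v≈w t))) ⟨
      g w             ∎

    linear-⊕ : ∀ {g} → Linear g → ∀ v a w → g (v ⊕ a · w) ≈ g v + a * g w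
    linear-⊕ {g} lin v a w = begin
      g (v ⊕ a · w)                   ≈⟨ lin c u (v ⊕ a · w) (λ t → +-cong (*-identityˡ _) (+-identityʳ _)) ⟩
      1# * g v + (a * g w + 0#)       ≈⟨ +-cong (*-identityˡ _) (+-identityʳ _) ⟩
      g v + a * g w                   ∎
      where
      c : Fin 2 → Carrier
      c zero       = 1#
      c (suc zero) = a
      u : Fin 2 → V
      u zero       = v
      u (suc zero) = w

    Linear-+ : ∀ {g h} → Linear g → Linear h → Linear (λ v → g v + h v)
    Linear-+ {g} {h} lg lh {j} c v w eq = begin
      g w + h w                                                  ≈⟨ +-cong (lg c v w eq) (lh c v w eq) ⟩
      sumF (λ i → c i * g (v i)) + sumF (λ i → c i * h (v i))    ≈⟨ sumF-+ j _ _ ⟨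
      sumF (λ i → c i * g (v i) + c i * h (v i))                 ≈⟨ (sumF-cong j λ i → distribˡ _ _ _) ⟨
      sumF (λ i → c i * (g (v i) + h (v i)))                     ∎

    Linear-scaleˡ : ∀ {g} a → Linear g → Linear (λ v → a * g v)
    Linear-scaleˡ {g} a lg {j} c v w eq = begin
      a * g w                              ≈⟨ *-congˡ (lg c v w eq) ⟩
      a * sumF (λ i → c i * g (v i))       ≈⟨ sumF-scale j a _ ⟨
      sumF (λ i → a * (c i * g (v i)))     ≈⟨ (sumF-cong j λ i → solve 3 (λ a c x → a :* (c :* x) := c :* (a :* x)) refl a (c i) (g (v i))) ⟩
      sumF (λ i → c i * (a * g (v i)))     ∎

    Linear-scaleʳ : ∀ {g} a → Linear g → Linear (λ v → g v * a)
    Linear-scaleʳ {g} a lg {j} c v w eq = begin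
      g w * a                              ≈⟨ *-comm _ _ ⟩
      a * g w                              ≈⟨ Linear-scaleˡ a lg c v w eq ⟩
      sumF (λ i → c i * (a * g (v i)))     ≈⟨ (sumF-cong j λ i → *-congˡ (*-comm _ _)) ⟩
      sumF (λ i → c i * (g (v i) * a))     ∎

    Linear-sumF : ∀ {n} {g : Fin n → V → Carrier} → (∀ j → Linear (g j)) → Linear (λ v → sumF λ j → g j v)
    Linear-sumF {n} {g} lg {m} c v w eq = begin
      sumF (λ j → g j w)                            ≈⟨ (sumF-cong n λ j → lg j c v w eq) ⟩
      sumF (λ j → sumF λ i → c i * g j (v i))       ≈⟨ sumF-swap n m _ ⟩
      sumF (λ i → sumF λ j → c i * g j (v i))       ≈⟨ (sumF-cong m λ i → sumF-scale n (c i) _) ⟩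
      sumF (λ i → c i * sumF λ j → g j (v i))       ∎

    Alternating₂ : ∀ n → (Vec V (suc n) → Carrier) → Set
    Alternating₂ zero    f = ⊤
    Alternating₂ (suc n) f = ∀ v ws → f (v ∷ v ∷ ws) ≈ 0#

    -- Only the leading arguments are constrained, but hereditarily, which yields
    -- linearity and alternation in all arguments.
    AltMultilinear : ∀ n → (Vec V n → Carrier) → Set
    AltMultilinear zero    f = ⊤
    AltMultilinear (suc n) f = (∀ ws → Linear (λ v → f (v ∷ ws)))
                             × (∀ v → AltMultilinear n (λ ws → f (v ∷ ws)))
                             × Alternating₂ n f

    AltMultilinear-scale : ∀ n a {f} → AltMultilinear n f → AltMultilinear n (λ ws → a * f ws)
    AltMultilinear-scale zero          a _                  = tt
    AltMultilinear-scale (suc zero)    a (lin , rec , alt)  =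
      (λ ws → Linear-scaleˡ a (lin ws)) , (λ v → tt) , tt
    AltMultilinear-scale (suc (suc n)) a (lin , rec , alt)  =
      (λ ws → Linear-scaleˡ a (lin ws)) , (λ v → AltMultilinear-scale (suc n) a (rec v)) ,
      λ v ws → trans (*-congˡ (alt v ws)) (zeroʳ a)

    AltMultilinear-sumF : ∀ n {m} {f : Fin m → Vec V n → Carrier} →
      (∀ j → AltMultilinear n (f j)) → AltMultilinear n (λ ws → sumF λ j → f j ws)
    AltMultilinear-sumF zero          p = tt
    AltMultilinear-sumF (suc zero)    p = (λ ws → Linear-sumF λ j → proj₁ (p j) ws) , (λ v → tt) , tt
    AltMultilinear-sumF (suc (suc n)) {m} p =
      (λ ws → Linear-sumF λ j → proj₁ (p j) ws) ,
      (λ v → AltMultilinear-sumF (suc n) λ j → proj₁ (proj₂ (p j)) v) ,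
      λ v ws → sumF-zero m λ j → proj₂ (proj₂ (p j)) v ws

    module _ {n} {f : Vec V (2 ℕ.+ n) → Carrier} (f-aml : AltMultilinear (2 ℕ.+ n) f) where

      private
        lin₁ = proj₁ f-aml
        lin₂ = λ v → proj₁ (proj₁ (proj₂ f-aml) v)
        alt  = proj₂ (proj₂ f-aml)

      swap₂ : ∀ v w ws → f (v ∷ w ∷ ws) ≈ - f (w ∷ v ∷ ws)
      swap₂ v w ws = +-inverseˡ-unique _ _ (begin
        f (v ∷ w ∷ ws) + f (w ∷ v ∷ ws)
          ≈⟨ +-cong left right ⟨
        f (v ∷ u ∷ ws) + f (w ∷ u ∷ ws)
          ≈⟨ +-congˡ (*-identityˡ _) ⟨
        f (v ∷ u ∷ ws) + 1# * f (w ∷ u ∷ ws)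
          ≈⟨ linear-⊕ (lin₁ (u ∷ ws)) v 1# w ⟨
        f (u ∷ u ∷ ws)
          ≈⟨ alt u ws ⟩
        0# ∎)
        where
        u = v ⊕ 1# · w
        left : f (v ∷ u ∷ ws) ≈ f (v ∷ w ∷ ws)
        left = begin
          f (v ∷ u ∷ ws)                        ≈⟨ linear-⊕ (lin₂ v ws) v 1# w ⟩
          f (v ∷ v ∷ ws) + 1# * f (v ∷ w ∷ ws)  ≈⟨ +-cong (alt v ws) (*-identityˡ _) ⟩
          0# + f (v ∷ w ∷ ws)                   ≈⟨ +-identityˡ _ ⟩
          f (v ∷ w ∷ ws)                        ∎
        right : f (w ∷ u ∷ ws) ≈ f (w ∷ v ∷ ws)
        right = begin
          f (w ∷ u ∷ ws)                        ≈⟨ linear-⊕ (lin₂ w ws) v 1# w ⟩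
          f (w ∷ v ∷ ws) + 1# * f (w ∷ w ∷ ws)  ≈⟨ +-congˡ (trans (*-identityˡ _) (alt w ws)) ⟩
          f (w ∷ v ∷ ws) + 0#                   ≈⟨ +-identityʳ _ ⟩
          f (w ∷ v ∷ ws)                        ∎

      swap₂-zero : ∀ v w ws → f (w ∷ v ∷ ws) ≈ 0# → f (v ∷ w ∷ ws) ≈ 0#
      swap₂-zero v w ws p = trans (swap₂ v w ws) (trans (-‿cong p) -0#≈0#)

    repeat-zero : ∀ {n f} → AltMultilinear (suc n) f → ∀ {v ws} → v ∈ᵥ ws → f (v ∷ ws) ≈ 0#
    repeat-zero aml@(_ , _ , alt) {v} {_ ∷ ws} (hereᵥ ≡.refl) = alt v ws
    repeat-zero {f = f} aml@(_ , rec , _) {v} {w ∷ ws} (thereᵥ v∈)    =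
      swap₂-zero {f = f} aml v w ws (repeat-zero (rec w) v∈)

    insert-sign : ∀ {n f} → AltMultilinear (suc n) f → ∀ {x v w} (p : Insert x v w) →
                  f w ≈ [-1]^ depth p * f (x ∷ v)
    insert-sign aml here = sym (*-identityˡ _)
    insert-sign {f = f} aml@(_ , rec , _) {x} {y ∷ v} {_ ∷ w} (there p) = begin
      f (y ∷ w)                            ≈⟨ insert-sign (rec y) p ⟩
      [-1]^ depth p * f (y ∷ x ∷ v)        ≈⟨ *-congˡ (swap₂ {f = f} aml y x v) ⟩
      [-1]^ depth p * - f (x ∷ y ∷ v)      ≈⟨ -‿distribʳ-* _ _ ⟨
      - ([-1]^ depth p * f (x ∷ y ∷ v))    ≈⟨ -‿distribˡ-* _ _ ⟩
      - ([-1]^ depth p) * f (x ∷ y ∷ v)    ∎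

    -- The dual form of spanning: a linear identity is checked on generators, with neither
    -- coefficients nor an order of the generators to keep track of.
    Spanning : (V → Set) → Set
    Spanning P = ∀ {g h} → Linear g → Linear h → (∀ v → P v → g v ≈ h v) → ∀ w → g w ≈ h w

    Spanning-mono : ∀ {P Q : V → Set} → (∀ v → P v → Q v) → Spanning P → Spanning Q
    Spanning-mono P⊆Q sp lg lh eq = sp lg lh λ v → eq v ∘ P⊆Q v

    basis-spanning : ∀ {v : Fin k → V} → IsBasis v → Spanning (λ u → ∃ λ i → u ≡ v i)
    basis-spanning {v} isB {g} {h} lg lh eq w with IsBasis.spanning isB w
    ... | c , c≈ = begin
      g w                          ≈⟨ lg c v w c≈ ⟩
      sumF (λ i → c i * g (v i))   ≈⟨ (sumF-cong k λ i → *-congˡ (eq (v i) (i , ≡.refl))) ⟩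
      sumF (λ i → c i * h (v i))   ≈⟨ lh c v w c≈ ⟨
      h w                          ∎

    Null : ∀ n → (Vec V n → Carrier) → (V → Set) → Set
    Null zero    f Z = ⊤
    Null (suc n) f Z = ∀ z → Z z → ∀ ws → f (z ∷ ws) ≈ 0#

    Null-⊥ : ∀ n f → Null n f (λ _ → ⊥)
    Null-⊥ zero    f = tt
    Null-⊥ (suc n) f = λ _ ()

    0-linear : Linear (λ _ → 0#)
    0-linear {j} c v w eq = sym (sumF-zero j λ i → zeroʳ _)

    -- By linearity the first argument may be taken among the generators. One in Z, already used in
    -- an outer argument, gives 0 by alternation; one in `vs` is pulled to the front at the cost of
    -- a sign and joins Z for the remaining arguments.
    vanishing : ∀ n {f} → AltMultilinear n f → ∀ (vs : Vec V n) → f vs ≈ 0# →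
                ∀ Z → Null n f Z → Spanning (λ v → v ∈ᵥ vs ⊎ Z v) → ∀ ws → f ws ≈ 0#
    vanishing zero    aml [] f≈0 Z null sp [] = f≈0
    vanishing (suc n) {f} aml@(lin , rec , alt) vs f≈0 Z null sp (w ∷ ws) = sp (lin ws) 0-linear on-generators w
      where
      null′ : ∀ n {f} → AltMultilinear (suc n) f → (∀ z → Z z → ∀ ws → f (z ∷ ws) ≈ 0#) →
              ∀ v → Null n (λ ws → f (v ∷ ws)) (λ u → u ≡ v ⊎ Z u)
      null′ zero    aml null v = tt
      null′ (suc n) aml null v z (inj₁ ≡.refl) ws = proj₂ (proj₂ aml) z ws
      null′ (suc n) {f} aml null v z (inj₂ Zz) ws = swap₂-zero {f = f} aml v z ws (null z Zz (v ∷ ws))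
      on-generators : ∀ v → v ∈ᵥ vs ⊎ Z v → f (v ∷ ws) ≈ 0#
      on-generators v (inj₂ Zv) = null v Zv ws
      on-generators v (inj₁ v∈) with remove v∈
      ... | vs′ , p = vanishing n (rec v) vs′ fv≈0 _ (null′ n aml null v) (Spanning-mono regroup sp) ws
        where
        fv≈0 : f (v ∷ vs′) ≈ 0#
        fv≈0 = *-cancel ([-1]^≉0 (depth p)) (trans (sym (insert-sign aml p)) (trans f≈0 (sym (zeroʳ _))))
        regroup : ∀ u → u ∈ᵥ vs ⊎ Z u → u ∈ᵥ vs′ ⊎ (u ≡ v ⊎ Z u)
        regroup u (inj₂ Zu) = inj₂ (inj₂ Zu)
        regroup u (inj₁ u∈) with Insert-∈ p u∈
        ... | inj₁ u∈′ = inj₁ u∈′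
        ... | inj₂ u≡v = inj₂ (inj₁ u≡v)

    detBy : ∀ {n} → (Fin n → V → Carrier) → Vec V n → Carrier
    detBy φ vs = det λ r c → φ c (lookup vs r)

    detBy-altMultilinear : ∀ n {φ : Fin n → V → Carrier} → (∀ j → Linear (φ j)) → AltMultilinear n (detBy φ)
    detBy-altMultilinear zero    lin = tt
    detBy-altMultilinear (suc n) {φ} lin =
      (λ ws → Linear-sumF λ j → Linear-scaleˡ (sign j) (Linear-scaleʳ (detBy (φ ∘ punchIn j) ws) (lin j))) ,
      (λ v → AltMultilinear-sumF n λ j → AltMultilinear-scale n (sign j) (AltMultilinear-scale n (φ j v)
               (detBy-altMultilinear n (lin ∘ punchIn j)))) ,
      alternating n φ
      where
      alternating : ∀ n (φ : Fin (suc n) → V → Carrier) → Alternating₂ n (detBy φ)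
      alternating zero    φ = tt
      alternating (suc n) φ v ws = alternating-sum n (λ j → φ j v)
        (λ γ → det λ r c → φ (γ c) (lookup ws r))
        λ f≗g → det-cong λ r c → reflexive (≡.cong (λ j → φ j (lookup ws r)) (f≗g c))

  module _ {k : ℕ} {B : Fin k → Vect k} (isB : IsBasis B) where

    coords-unique : ∀ {x y : Fin k → Carrier} → (∀ t → lincomb x B t ≈ lincomb y B t) → ∀ i → x i ≈ y i
    coords-unique {x} {y} eq i = trans (+-inverseˡ-unique _ _ (IsBasis.independent isB (λ j → x j + - y j) zero-comb i)) (-‿involutive _)
      where
      zero-comb : ∀ t → lincomb (λ j → x j + - y j) B t ≈ 0#
      zero-comb t = begin
        sumF (λ j → (x j + - y j) * B j t)                       ≈⟨ (sumF-cong k λ j → trans (distribʳ _ _ _) (+-congˡ (sym (-‿distribˡ-* _ _)))) ⟩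
        sumF (λ j → x j * B j t + - (y j * B j t))               ≈⟨ sumF-+ k _ _ ⟩
        lincomb x B t + sumF (λ j → - (y j * B j t))             ≈⟨ +-cong (eq t) (sumF-neg k _) ⟩
        lincomb y B t + - lincomb y B t                          ≈⟨ -‿inverseʳ _ ⟩
        0#                                                       ∎

    coords-lincomb : ∀ w t → lincomb (coords isB w) B t ≈ w t
    coords-lincomb w = proj₂ (IsBasis.spanning isB w)

    -- `coords` takes its coefficients from an arbitrary witness of spanning; independence of B
    -- makes them unique and therefore linear.
    coords-linear : ∀ j → Linear (λ w → coords isB w j)
    coords-linear j {m} c v w eq = coords-unique {y = λ j → sumF λ i → c i * coords isB (v i) j} (λ t → begin
      lincomb (coords isB w) B t
        ≈⟨ coords-lincomb w t ⟩
      w t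
        ≈⟨ eq t ⟨
      sumF (λ i → c i * v i t)
        ≈⟨ (sumF-cong m λ i → *-congˡ (coords-lincomb (v i) t)) ⟨
      sumF (λ i → c i * sumF λ j → coords isB (v i) j * B j t)
        ≈⟨ (sumF-cong m λ i → trans (sym (sumF-scale k (c i) _)) (sumF-cong k λ j → sym (*-assoc _ _ _))) ⟩
      sumF (λ i → sumF λ j → (c i * coords isB (v i) j) * B j t)
        ≈⟨ sumF-swap m k _ ⟩
      sumF (λ j → sumF λ i → (c i * coords isB (v i) j) * B j t)
        ≈⟨ (sumF-cong k λ j → trans (sumF-cong m λ i → *-comm _ _) (trans (sumF-scale m (B j t) _) (*-comm _ _))) ⟩
      sumF (λ j → (sumF λ i → c i * coords isB (v i) j) * B j t) ∎) j

    coords-basis : ∀ i j → coords isB (B i) j ≈ δ i j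
    coords-basis i = coords-unique λ t → trans (coords-lincomb (B i) t) (sym (δ-sum i (λ j → B j t)))

    detB : Vec (Vect k) k → Carrier
    detB = detBy (λ j w → coords isB w j)

    detB-altMultilinear : AltMultilinear k detB
    detB-altMultilinear = detBy-altMultilinear k coords-linear

    -- Vanishing on a spanning tuple would make the form vanish on B too, where the matrix of
    -- coordinates is the identity.
    detB≉0 : ∀ vs → Spanning (_∈ᵥ vs) → detB vs ≉ 0#
    detB≉0 vs sp det≈0 = 1≉0 (begin
      1#                      ≈⟨ det-δ k ⟨
      det (δ {k})             ≈⟨ (det-cong λ r c → trans (reflexive (≡.cong (λ v → coords isB v c) (Vec.lookup∘tabulate B r))) (coords-basis r c)) ⟨
      detB (Vec.tabulate B)   ≈⟨ vanishing k detB-altMultilinear vs det≈0 (λ _ → ⊥) (Null-⊥ k detB) (Spanning-mono (λ _ → inj₁) sp) (Vec.tabulate B) ⟩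
      0#                      ∎)

-- The form D(u, y) = det(u, y, A) and its Plücker relation

module Form (F : FiniteField) {k n : ℕ}
  (f : Vec (LinAlg.Vect F k) (2 ℕ.+ n) → FiniteField.Carrier F)
  (aml : Multilinear.AltMultilinear F (2 ℕ.+ n) f)
  (As : Vec (LinAlg.Vect F k) n) where
  open FiniteField F hiding (zero)
  open Field F
  open Multilinear F
  open LinAlg F

  private
    V : Set
    V = Vect k

  D : V → V → Carrier
  D u y = f (u ∷ y ∷ As)

  D-linearˡ : ∀ y → Linear (λ u → D u y)
  D-linearˡ y = proj₁ aml (y ∷ As)

  D-linearʳ : ∀ u → Linear (D u)
  D-linearʳ u = proj₁ (proj₁ (proj₂ aml) u) As

  D-alt : ∀ x → D x x ≈ 0#
  D-alt x = proj₂ (proj₂ aml) x As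

  D-anti : ∀ x y → D x y ≈ - D y x
  D-anti x y = swap₂ {f = f} aml x y As

  D-pencil : ∀ a b c → ∃ λ w → ∀ x → D w x ≈ D a x + c * D b x
  D-pencil a b c = a ⊕ c · b , λ x → linear-⊕ (D-linearˡ x) a c b

  D-zeroʳ : ∀ {v} u → v ∈ᵥ As → D u v ≈ 0#
  D-zeroʳ u v∈ = repeat-zero (proj₁ (proj₂ aml) u) v∈

  D-zeroˡ : ∀ {v} u → v ∈ᵥ As → D v u ≈ 0#
  D-zeroˡ u v∈ = repeat-zero {f = f} aml (thereᵥ v∈)

  private
    Sp : V → V → Set
    Sp p q = Spanning (_∈ᵥ (p ∷ q ∷ As))

    ext : ∀ {p q} → Sp p q → ∀ {g h} → Linear g → Linear h → g p ≈ h p → g q ≈ h q →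
          (∀ v → v ∈ᵥ As → g v ≈ h v) → ∀ w → g w ≈ h w
    ext sp lg lh gp gq gA = sp lg lh λ
      { v (hereᵥ ≡.refl)          → gp
      ; v (thereᵥ (hereᵥ ≡.refl)) → gq
      ; v (thereᵥ (thereᵥ v∈))    → gA v v∈ }

    zero₂ : ∀ {x y x′ y′ x″ y″} → x * y ≈ 0# → x′ * y′ ≈ 0# → x″ * y″ ≈ 0# → x * y + x′ * y′ ≈ x″ * y″
    zero₂ p q r = trans (+-cong p q) (trans (+-identityˡ 0#) (sym r))

    *0 : ∀ {x y} → y ≈ 0# → x * y ≈ 0#
    *0 p = trans (*-congˡ p) (zeroʳ _)

    0* : ∀ {x y} → x ≈ 0# → x * y ≈ 0#
    0* p = trans (*-congʳ p) (zeroˡ _)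

    plücker₁ : ∀ {p q} → Sp p q → ∀ b a → D a b * D p q + D p b * D q a ≈ D p a * D q b
    plücker₁ {p} {q} sp b = ext sp
      (Linear-+ (Linear-scaleʳ (D p q) (D-linearˡ b)) (Linear-scaleˡ (D p b) (D-linearʳ q)))
      (Linear-scaleʳ (D q b) (D-linearʳ p))
      (begin
        D p b * D p q + D p b * D q p    ≈⟨ distribˡ _ _ _ ⟨
        D p b * (D p q + D q p)          ≈⟨ *0 (trans (+-congʳ (D-anti p q)) (-‿inverseˡ _)) ⟩
        0#                               ≈⟨ 0* (D-alt p) ⟨
        D p p * D q b                    ∎)
      (trans (+-cong (*-comm _ _) (*0 (D-alt q))) (+-identityʳ _))
      λ v v∈ → zero₂ (0* (D-zeroˡ b v∈)) (*0 (D-zeroʳ q v∈)) (0* (D-zeroʳ p v∈))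

    plücker₂ : ∀ {p q} → Sp p q → ∀ a b t → D a b * D p t + D p b * D t a ≈ D p a * D t b
    plücker₂ {p} {q} sp a b = ext sp
      (Linear-+ (Linear-scaleˡ (D a b) (D-linearʳ p)) (Linear-scaleˡ (D p b) (D-linearˡ a)))
      (Linear-scaleˡ (D p a) (D-linearˡ b))
      (trans (+-cong (*0 (D-alt p)) (*-comm _ _)) (+-identityˡ _))
      (plücker₁ sp b a)
      λ v v∈ → zero₂ (*0 (D-zeroʳ p v∈)) (*0 (D-zeroˡ a v∈)) (*0 (D-zeroˡ b v∈))

  -- Both sides are linear in a, t and s separately and vanish as soon as one of these lies in `As`,
  -- so each variable need only be tested on p and q: a in `plücker₁`, t in `plücker₂`, s here. What
  -- remains follows from alternation and antisymmetry.
  D-plücker : ∀ {p q} → Spanning (_∈ᵥ (p ∷ q ∷ As)) →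
              ∀ a b s t → D a b * D s t + D s b * D t a ≈ D s a * D t b
  D-plücker {p} {q} sp a b s t = ext sp
    (Linear-+ (Linear-scaleˡ (D a b) (D-linearˡ t)) (Linear-scaleʳ (D t a) (D-linearˡ b)))
    (Linear-scaleʳ (D t b) (D-linearˡ a))
    (plücker₂ sp a b t)
    (plücker₂ (Spanning-mono swapped sp) a b t)
    (λ v v∈ → zero₂ (*0 (D-zeroˡ t v∈)) (0* (D-zeroˡ b v∈)) (0* (D-zeroˡ a v∈)))
    s
    where
    swapped : ∀ v → v ∈ᵥ (p ∷ q ∷ As) → v ∈ᵥ (q ∷ p ∷ As)
    swapped v (hereᵥ e)           = thereᵥ (hereᵥ e)
    swapped v (thereᵥ (hereᵥ e))  = hereᵥ e
    swapped v (thereᵥ (thereᵥ e)) = thereᵥ (thereᵥ e)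

-- Subsets, their increasing lists, and families of distinct indices

private
  variable
    m : ℕ

insert : Fin m → Subset m → Subset m
insert x A = A [ x ]≔ inside

∣insert∣ : ∀ (A : Subset m) {x} → x ∉ A → ∣ insert x A ∣ ≡ suc ∣ A ∣
∣insert∣ (inside  ∷ A) {zero}  x∉ = contradiction here x∉
∣insert∣ (outside ∷ A) {zero}  x∉ = ≡.refl
∣insert∣ (inside  ∷ A) {suc x} x∉ = ≡.cong suc (∣insert∣ A (x∉ ∘ there))
∣insert∣ (outside ∷ A) {suc x} x∉ = ∣insert∣ A (x∉ ∘ there)

x∈insert : ∀ (A : Subset m) x → x ∈ insert x A
x∈insert (s ∷ A) zero    = here
x∈insert (s ∷ A) (suc x) = there (x∈insert A x)

⊆-insert : ∀ (A : Subset m) x → A ⊆ insert x A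
⊆-insert (s ∷ A) zero    here       = here
⊆-insert (s ∷ A) zero    (there y∈) = there y∈
⊆-insert (s ∷ A) (suc x) here       = here
⊆-insert (s ∷ A) (suc x) (there y∈) = there (⊆-insert A x y∈)

∈-insert⁻ : ∀ (A : Subset m) {x y} → y ∈ insert x A → y ≡ x ⊎ y ∈ A
∈-insert⁻ (s ∷ A) {zero}  here       = inj₁ ≡.refl
∈-insert⁻ (s ∷ A) {zero}  (there y∈) = inj₂ (there y∈)
∈-insert⁻ (s ∷ A) {suc x} here       = inj₂ here
∈-insert⁻ (s ∷ A) {suc x} (there y∈) with ∈-insert⁻ A y∈
... | inj₁ y≡x = inj₁ (≡.cong suc y≡x)
... | inj₂ y∈A = inj₂ (there y∈A)

-- `toVec` lists a subset in increasing order, the order of the rows in `detUC`, so x lands at its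
-- sorted place, whose depth gives the sign. The `cast` only adjusts the length index.
toVec-insert : ∀ (A : Subset m) {x} → x ∉ A → .(eq : ∣ insert x A ∣ ≡ suc ∣ A ∣) →
               Insert x (toVec A) (cast eq (toVec (insert x A)))
toVec-insert (inside  ∷ A) {zero}  x∉ eq = contradiction here x∉
toVec-insert (outside ∷ A) {zero}  x∉ eq
  rewrite Vec.cast-is-id ≡.refl (Vec.map Fin.suc (toVec A)) = here
toVec-insert (inside  ∷ A) {suc x} x∉ eq
  rewrite ≡.sym (Vec.map-cast Fin.suc (ℕ.suc-injective eq) (toVec (insert x A))) =
  there (Insert-map suc (toVec-insert A (x∉ ∘ there) (ℕ.suc-injective eq)))
toVec-insert (outside ∷ A) {suc x} x∉ eq
  rewrite ≡.sym (Vec.map-cast Fin.suc eq (toVec (insert x A))) =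
  Insert-map suc (toVec-insert A (x∉ ∘ there) eq)

elems : Subset m → List (Fin m)
elems A = toList (toVec A)

elems-∈ : ∀ (A : Subset m) {x} → x ∈ₗ elems A → x ∈ A
elems-∈ (inside  ∷ A) (here ≡.refl) = here
elems-∈ (inside  ∷ A) (there x∈) rewrite Vec.toList-map Fin.suc (toVec A) with ∈ₗ.∈-map⁻ suc x∈
... | y , y∈ , ≡.refl = there (elems-∈ A y∈)
elems-∈ (outside ∷ A) x∈ rewrite Vec.toList-map Fin.suc (toVec A) with ∈ₗ.∈-map⁻ suc x∈
... | y , y∈ , ≡.refl = there (elems-∈ A y∈)

toVec-∈ : ∀ (A : Subset m) {x} → x ∈ᵥ toVec A → x ∈ A
toVec-∈ A x∈ = elems-∈ A (∈ᵥ.∈-toList⁺ x∈)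

∈-elems : ∀ (A : Subset m) {x} → x ∈ A → x ∈ₗ elems A
∈-elems (inside  ∷ A) here = here ≡.refl
∈-elems (inside  ∷ A) (there x∈) rewrite Vec.toList-map Fin.suc (toVec A) = there (∈ₗ.∈-map⁺ suc (∈-elems A x∈))
∈-elems (outside ∷ A) (there x∈) rewrite Vec.toList-map Fin.suc (toVec A) = ∈ₗ.∈-map⁺ suc (∈-elems A x∈)

length-elems : ∀ (A : Subset m) → length (elems A) ≡ ∣ A ∣
length-elems A = Vec.length-toList (toVec A)

elems-unique : ∀ (A : Subset m) → Unique (elems A)
elems-unique []            = []
elems-unique (inside  ∷ A) rewrite Vec.toList-map Fin.suc (toVec A) =
  All.map⁺ (All.universal (λ _ ()) (elems A)) ∷ Unique.map⁺ Fin.suc-injective (elems-unique A)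
elems-unique (outside ∷ A) rewrite Vec.toList-map Fin.suc (toVec A) =
  Unique.map⁺ Fin.suc-injective (elems-unique A)

subset-of-size : ∀ {j m} → j ≤ m → ∃ λ (C : Subset m) → ∣ C ∣ ≡ j
subset-of-size {m = m} z≤n = ∅ , Subset.∣⊥∣≡0 m
subset-of-size (s≤s j≤m) with subset-of-size j≤m
... | C , eq = inside ∷ C , ≡.cong suc eq

-- `IsArc` speaks of subsets, while the families at hand are listed in arbitrary order; the order
-- lost here does not matter to `Spanning`.
setOf : ∀ {N n} → Vec (Fin N) n → Subset N
setOf []      = ∅
setOf (x ∷ v) = insert x (setOf v)

setOf-∈ : ∀ {N n} (v : Vec (Fin N) n) {x} → x ∈ setOf v → x ∈ᵥ v
setOf-∈ []      x∈ = contradiction x∈ Subset.∉⊥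
setOf-∈ (y ∷ v) x∈ with ∈-insert⁻ (setOf v) x∈
... | inj₁ x≡y = hereᵥ x≡y
... | inj₂ x∈v = thereᵥ (setOf-∈ v x∈v)

∣setOf∣ : ∀ {N n} (v : Vec (Fin N) n) → Unique (toList v) → ∣ setOf v ∣ ≡ n
∣setOf∣ {N} []  _        = Subset.∣⊥∣≡0 N
∣setOf∣ (x ∷ v) (x∉ ∷ u) = ≡.trans
  (∣insert∣ (setOf v) λ x∈ → All.All¬⇒¬Any x∉ (∈ᵥ.∈-toList⁺ (setOf-∈ v x∈)))
  (≡.cong suc (∣setOf∣ v u))

module _ {A : Set} {R : A → A → Set} where

  AllPairs-++⁻ : ∀ xs {ys} → AllPairs R (xs ++ ys) →
                 AllPairs R xs × All (λ x → All (R x) ys) xs × AllPairs R ys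
  AllPairs-++⁻ []       ps       = [] , [] , ps
  AllPairs-++⁻ (x ∷ xs) (p ∷ ps) with AllPairs-++⁻ xs ps
  ... | l , c , r = All.++⁻ˡ xs p ∷ l , All.++⁻ʳ xs p ∷ c , r

-- Brings distinctness into the form in which the arc property yields independence: two members of L
-- completed by `as`.
unique-pairs : ∀ {A : Set} {as L : List A} → Unique (L ++ as) →
               AllPairs (λ s t → Unique (s ∷ t ∷ as)) L
unique-pairs {as = as} {L} u with AllPairs-++⁻ L u
... | uL , c , uas = go uL c
  where
  go : ∀ {L} → Unique L → All (λ x → All (x ≢_) as) L → AllPairs (λ s t → Unique (s ∷ t ∷ as)) L
  go []       []       = []
  go (p ∷ ps) (q ∷ qs) = All.zipWith (λ (s≢t , t∉) → (s≢t ∷ q) ∷ t∉ ∷ uas) (p , qs) ∷ go ps qs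

-- Sums over the sets that exceed A by one element

module SubsetSum (F : FiniteField) where
  open FiniteField F hiding (zero)
  open Field F
  open LinAlg F
  open Multilinear F

  private
    sum-map : ∀ {m} (s : _) (h : Subset (suc m) → Carrier) →
              sumL (map (s ∷_) (allSubsets m)) h ≈ sumL (allSubsets m) (h ∘ (s ∷_))
    sum-map {m} s h = reflexive (sumL-map (s ∷_) (allSubsets m))

    sum-none : ∀ {m} (s : _) (h : Subset (suc m) → Carrier) → (∀ C → h (s ∷ C) ≈ 0#) →
               sumL (map (s ∷_) (allSubsets m)) h ≈ 0#
    sum-none {m} s h h≈0 = trans (sum-map s h) (sumL-zero (allSubsets m) (All.universal h≈0 _))

  module _ {m} (A : Subset m) (j : ℕ) (h : Subset m → Carrier) where

    SupportedAbove : Set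
    SupportedAbove = (∀ C → ¬ A ⊆ C → h C ≈ 0#) × (∀ C → ∣ C ∣ ≢ j ℕ.+ ∣ A ∣ → h C ≈ 0#)

  private
    no-inside : ∀ {C : Subset m} {A} → ¬ (inside ∷ A ⊆ outside ∷ C)
    no-inside A⊆C with A⊆C here
    ... | ()

    tail-inside : ∀ {m} (A : Subset m) {j h} → SupportedAbove (inside ∷ A) j h →
                  SupportedAbove A j (h ∘ (inside ∷_))
    tail-inside A {j} (p , q) =
      (λ C A⊈C → p _ (A⊈C ∘ Subset.drop-∷-⊆)) ,
      (λ C ≢ → q _ λ eq → ≢ (ℕ.suc-injective (≡.trans eq (ℕ.+-suc j ∣ A ∣))))

    tail-outside : ∀ {m} (A : Subset m) {j h} → SupportedAbove (outside ∷ A) j h →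
                   SupportedAbove A j (h ∘ (outside ∷_))
    tail-outside A (p , q) = (λ C A⊈C → p _ (A⊈C ∘ Subset.drop-∷-⊆)) , (λ C → q _)

    tail-outside-inside : ∀ {m} (A : Subset m) {j h} → SupportedAbove (outside ∷ A) (suc j) h →
                          SupportedAbove A j (h ∘ (inside ∷_))
    tail-outside-inside A (p , q) =
      (λ C A⊈C → p _ (A⊈C ∘ Subset.drop-∷-⊆)) , (λ C ≢ → q _ (≢ ∘ ℕ.suc-injective))

    sum-supersets₀ : ∀ {m} (A : Subset m) h → SupportedAbove A 0 h → sumL (allSubsets m) h ≈ h A
    sum-supersets₀ [] h _ = +-identityʳ _
    sum-supersets₀ {suc m} (inside ∷ A) h s@(p , q) = begin
      sumL (allSubsets (suc m)) h  ≈⟨ sumL-++ (map (inside ∷_) (allSubsets m)) ⟩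
      _                            ≈⟨ +-cong (trans (sum-map inside h) (sum-supersets₀ A _ (tail-inside A s)))
                                             (sum-none outside h λ C → p _ no-inside) ⟩
      h (inside ∷ A) + 0#          ≈⟨ +-identityʳ _ ⟩
      h (inside ∷ A)               ∎
    sum-supersets₀ {suc m} (outside ∷ A) h s@(p , q) = begin
      sumL (allSubsets (suc m)) h  ≈⟨ sumL-++ (map (inside ∷_) (allSubsets m)) ⟩
      _                            ≈⟨ +-cong (sum-none inside h bigger)
                                             (trans (sum-map outside h) (sum-supersets₀ A _ (tail-outside A s))) ⟩
      0# + h (outside ∷ A)         ≈⟨ +-identityˡ _ ⟩
      h (outside ∷ A)              ∎
      where
      bigger : ∀ C → h (inside ∷ C) ≈ 0#
      bigger C with A Subset.⊆? C
      ... | no  A⊈C = p _ (A⊈C ∘ Subset.drop-∷-⊆)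
      ... | yes A⊆C = q _ λ eq → ℕ.<⇒≢ (s≤s (Subset.p⊆q⇒∣p∣≤∣q∣ A⊆C)) (≡.sym eq)

  -- The sets of the support are the `insert x A` for x outside A. In the recursion the subsets
  -- containing `zero` supply the summand x = zero if `zero` is outside A, and the others then
  -- supply the later x; if `zero` lies in A, that summand is 0.
  sum-supersets : ∀ {m} (A : Subset m) h → SupportedAbove A 1 h →
                  sumL (allSubsets m) h ≈ sumF λ x → if lookup A x then 0# else h (insert x A)
  sum-supersets [] h (p , q) = trans (+-identityʳ _) (q [] λ ())
  sum-supersets {suc m} (inside ∷ A) h s@(p , q) = begin
    sumL (allSubsets (suc m)) h  ≈⟨ sumL-++ (map (inside ∷_) (allSubsets m)) ⟩
    _                            ≈⟨ +-cong (trans (sum-map inside h) (sum-supersets A _ (tail-inside A s)))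
                                           (sum-none outside h λ C → p _ no-inside) ⟩
    _ + 0#                       ≈⟨ +-comm _ _ ⟩
    0# + _                       ∎
  sum-supersets {suc m} (outside ∷ A) h s = trans (sumL-++ (map (inside ∷_) (allSubsets m)))
    (+-cong (trans (sum-map inside h) (sum-supersets₀ A _ (tail-outside-inside A s)))
            (trans (sum-map outside h) (sum-supersets A _ (tail-outside A s))))

  sumF-tabulate : ∀ n {A : Set} (g : Fin n → A) {f : A → Carrier} → sumL (tabulate g) f ≡ sumF (f ∘ g)
  sumF-tabulate zero    g     = ≡.refl
  sumF-tabulate (suc n) g {f} = ≡.cong (f (g zero) +_) (sumF-tabulate n (g ∘ suc))

  prodF-lookup : ∀ {A : Set} {n} (v : Vec A n) {f : A → Carrier} → prodF (f ∘ lookup v) ≡ prodL (toList v) f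
  prodF-lookup []          = ≡.refl
  prodF-lookup (x ∷ v) {f} = ≡.cong (f x *_) (prodF-lookup v)

  prodF-cong : ∀ n {f g : Fin n → Carrier} → (∀ i → f i ≈ g i) → prodF f ≈ prodF g
  prodF-cong zero    p = refl
  prodF-cong (suc n) p = *-cong (p zero) (prodF-cong n (p ∘ suc))

-- The vector without zero entries

module Kernel (F : FiniteField) {d m N : ℕ} (G : Fin m → LinAlg.Vect F (suc d))
  {B : Fin (suc d) → LinAlg.Vect F (suc d)} (isB : LinAlg.IsBasis F B)
  (S : Fin N → LinAlg.Vect F (suc d)) where
  open LinAlg F
  open FiniteField F hiding (zero)
  open Field F using (prodL; inv; prodL≉0; inv≉0; *-nonzero)
  open Multilinear F
  open Mat G isB
  open import Relation.Binary.Reasoning.Setoid setoid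

  -- The products run over all of S and G: a vector that is among the rows of C gives the
  -- determinant 0, which inv 0 = 1 drops from the product.
  kernel : (C : Subset m) → ∣ C ∣ ≡ d → Carrier
  kernel C e = prodL (allFin N) (λ s → inv (detUC (S s) C e)) * prodL (allFin m) (λ z → inv (detUC (G z) C e))

  kernel≉0 : ∀ C e → kernel C e ≉ 0#
  kernel≉0 C e = *-nonzero (prodL≉0 (allFin N) λ _ → inv≉0 _) (prodL≉0 (allFin m) λ _ → inv≉0 _)

  entry-inside : ∀ {C U A} e → A ⊆ C → C ⊆ ∁ U → entry C e U A ≡ prodU U C e
  entry-inside {C} {U} {A} e A⊆C C⊆∁U with A Subset.⊆? C | C Subset.⊆? ∁ U
  ... | yes _   | yes _    = ≡.refl
  ... | no A⊈C  | _        = contradiction (λ {x} → A⊆C {x}) A⊈C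
  ... | yes _   | no C⊈∁U  = contradiction (λ {x} → C⊆∁U {x}) C⊈∁U

  entry-⊈ˡ : ∀ {C U A} e → ¬ A ⊆ C → entry C e U A ≡ 0#
  entry-⊈ˡ {C} {U} {A} e A⊈C with A Subset.⊆? C
  ... | yes A⊆C = contradiction (λ {x} → A⊆C {x}) A⊈C
  ... | no _    = ≡.refl

  entry-⊈ʳ : ∀ {C U A} e → ¬ C ⊆ ∁ U → entry C e U A ≡ 0#
  entry-⊈ʳ {C} {U} {A} e C⊈∁U with A Subset.⊆? C | C Subset.⊆? ∁ U
  ... | yes _ | yes C⊆∁U = contradiction (λ {x} → C⊆∁U {x}) C⊈∁U
  ... | yes _ | no _     = ≡.refl
  ... | no _  | _        = ≡.refl

  detUC-cong : ∀ {u v} C e → (∀ t → u t ≈ v t) → detUC u C e ≈ detUC v C e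
  detUC-cong {u} {v} C e u≈v = sumF-cong (suc d)
    {λ j → sign j * (coords isB u j * det λ r c → coords isB (subfamily G C e r) (punchIn j c))}
    {λ j → sign j * (coords isB v j * det λ r c → coords isB (subfamily G C e r) (punchIn j c))}
    λ j → *-congˡ (*-congʳ (linear-cong (coords-linear isB j) u≈v))

  module _ (ι : Fin m → Fin N) (S≈G : ∀ i t → S (ι i) t ≈ G i t) where

    detUC-rows : ∀ u C e → detUC u C e ≈ detB isB (u ∷ Vec.map (S ∘ ι) (cast e (toVec C)))
    detUC-rows u C e = sumF-cong (suc d)
      {λ j → sign j * (coords isB u j * det λ r c → coords isB (subfamily G C e r) (punchIn j c))}
      {λ j → sign j * (coords isB u j * det λ r c → coords isB (lookup rows r) (punchIn j c))}
      λ j → *-congˡ (*-congˡ (det-cong λ r c → row r (punchIn j c)))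
      where
      rows = Vec.map (S ∘ ι) (cast e (toVec C))
      row : ∀ r c → coords isB (subfamily G C e r) c ≈ coords isB (lookup rows r) c
      row r c = begin
        coords isB (G (elemAt C e r)) c         ≈⟨ linear-cong (coords-linear isB c) (S≈G (elemAt C e r)) ⟨
        coords isB (S (ι (elemAt C e r))) c     ≡⟨ ≡.cong (λ i → coords isB (S (ι i)) c) (Vec.lookup-cast₁ e (toVec C) r) ⟨
        coords isB (S (ι (lookup (cast e (toVec C)) r))) c ≡⟨ ≡.cong (λ v → coords isB v c) (Vec.lookup-map r (S ∘ ι) (cast e (toVec C))) ⟨
        coords isB (lookup rows r) c            ∎

-- The product of the vector with a single column

module ColumnCount where
  open ℕ.+-*-Solver

  -- With a = |A|, u = |U| and e = |E|, the bound n + d ≤ |G| becomes the nonemptiness of E.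
  bound-cancel : ∀ a u {e} → u ℕ.+ suc a ≤ a ℕ.+ (u ℕ.+ e) → 1 ≤ e
  bound-cancel a u {e} le = ℕ.+-cancelˡ-≤ (a ℕ.+ u) 1 e (≡.subst₂ _≤_
    (solve 2 (λ a u → u :+ (con 1 :+ a) := (a :+ u) :+ con 1) ≡.refl a u)
    (≡.sym (ℕ.+-assoc a u e)) le)

  -- Here e + j = |I|, d = a + 1, |S| = a + |I| and |G| = a + u + |E|, so the prescribed size of S
  -- turns into |I| + |E| = q + 3.
  total-cancel : ∀ a u e j q → (a ℕ.+ (e ℕ.+ j)) ℕ.+ (a ℕ.+ (u ℕ.+ e)) ≡ q ℕ.+ 2 ℕ.* suc a ℕ.+ 1 ℕ.+ u →
                 (e ℕ.+ j) ℕ.+ e ≡ 3 ℕ.+ q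
  total-cancel a u e j q eq = ℕ.+-cancelˡ-≡ (a ℕ.+ a ℕ.+ u) _ _ (≡.trans
    (solve 4 (λ a u x y → (a :+ a :+ u) :+ ((x :+ y) :+ x) := (a :+ (x :+ y)) :+ (a :+ (u :+ x))) ≡.refl a u e j)
    (≡.trans eq (solve 3 (λ a u q → q :+ con 2 :* (con 1 :+ a) :+ con 1 :+ u := (a :+ a :+ u) :+ (con 3 :+ q)) ≡.refl a u q)))

-- `Xs` indexes E, and `Js` the rest of I: the image of U and the indices outside the image of ι.
-- The dimension is spelled 2 + |A| so that u ∷ y ∷ As has the length that `detB` takes.
module Column (F : FiniteField) {m N : ℕ} (A U : Subset m)
  (G : Fin m → LinAlg.Vect F (2 ℕ.+ ∣ A ∣))
  {B : Fin (2 ℕ.+ ∣ A ∣) → LinAlg.Vect F (2 ℕ.+ ∣ A ∣)} (isB : LinAlg.IsBasis F B)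
  (S : Fin N → LinAlg.Vect F (2 ℕ.+ ∣ A ∣)) (arcS : LinAlg.IsArc F (2 ℕ.+ ∣ A ∣) S)
  (ι : Fin m → Fin N) (ι-injective : Injective _≡_ _≡_ ι) (S≈G : ∀ i t → FiniteField._≈_ F (S (ι i) t) (G i t))
  (Xs : List (Fin m)) (Js : List (Fin N))
  (perm-m : allFin m ↭ elems A ++ (elems U ++ Xs))
  (perm-N : allFin N ↭ map ι (elems A) ++ (map ι Xs ++ Js))
  (A⊆∁U : A ⊆ ∁ U)
  (bound : ∣ U ∣ ℕ.+ suc ∣ A ∣ ≤ m)
  (total : N ℕ.+ m ≡ FiniteField.order F ℕ.+ 2 ℕ.* suc ∣ A ∣ ℕ.+ 1 ℕ.+ ∣ U ∣)
  where
  open LinAlg F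
  open FiniteField F hiding (zero)
  open Field F
  open Multilinear F
  open Kernel F G isB S
  open Mat G isB
  open SubsetSum F
  open ColumnCount using (bound-cancel; total-cancel)
  open Form F (detB isB) (detB-altMultilinear isB) (Vec.map (S ∘ ι) (toVec A))

  private
    k : ℕ
    k = 2 ℕ.+ ∣ A ∣

    As : Vec (Vect k) ∣ A ∣
    As = Vec.map (S ∘ ι) (toVec A)

    Ι : List (Fin N)
    Ι = map ι Xs ++ Js

    e j : ℕ
    e = length Xs
    j = length Js

    unique-m : Unique ((elems U ++ Xs) ++ elems A)
    unique-m = PermSP.Unique-resp-↭ (≡.setoid _)
      (Perm.↭⇒↭ₛ (Perm.trans perm-m (PermP.++-comm (elems A) (elems U ++ Xs)))) (Unique.allFin⁺ m)

    unique-N : Unique (Ι ++ map ι (elems A))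
    unique-N = PermSP.Unique-resp-↭ (≡.setoid _)
      (Perm.↭⇒↭ₛ (Perm.trans perm-N (PermP.++-comm (map ι (elems A)) Ι))) (Unique.allFin⁺ N)

    m≡ : m ≡ ∣ A ∣ ℕ.+ (∣ U ∣ ℕ.+ e)
    m≡ = ≡.trans (≡.sym (List.length-tabulate id)) (≡.trans (PermP.↭-length perm-m)
      (≡.trans (List.length-++ (elems A)) (≡.cong₂ ℕ._+_ (length-elems A)
        (≡.trans (List.length-++ (elems U)) (≡.cong (ℕ._+ e) (length-elems U))))))

    lengthΙ : length Ι ≡ e ℕ.+ j
    lengthΙ = ≡.trans (List.length-++ (map ι Xs)) (≡.cong (ℕ._+ j) (List.length-map ι Xs))

    N≡ : N ≡ ∣ A ∣ ℕ.+ (e ℕ.+ j)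
    N≡ = ≡.trans (≡.sym (List.length-tabulate id)) (≡.trans (PermP.↭-length perm-N)
      (≡.trans (List.length-++ (map ι (elems A)))
        (≡.cong₂ ℕ._+_ (≡.trans (List.length-map ι (elems A)) (length-elems A)) lengthΙ)))

    1≤e : 1 ≤ e
    1≤e = bound-cancel ∣ A ∣ ∣ U ∣ (≡.subst (∣ U ∣ ℕ.+ suc ∣ A ∣ ≤_) m≡ bound)

    count : (e ℕ.+ j) ℕ.+ e ≡ 3 ℕ.+ order
    count = total-cancel ∣ A ∣ ∣ U ∣ e j order (≡.trans (≡.cong₂ ℕ._+_ (≡.sym N≡) (≡.sym m≡)) total)

    spanning-family : (v : Vec (Fin N) k) → Unique (toList v) → Spanning (_∈ᵥ Vec.map S v)
    spanning-family v u = Spanning-mono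
      (λ { _ (i , ≡.refl) → ∈ᵥ.∈-map⁺ S (setOf-∈ v (toVec-∈ (setOf v) (∈ᵥ.∈-lookup _ (toVec (setOf v))))) })
      (basis-spanning (proj₂ arcS (setOf v) (∣setOf∣ v u)))

    spanning-pair : ∀ {s t} → Unique (s ∷ t ∷ map ι (elems A)) → Spanning (_∈ᵥ (S s ∷ S t ∷ As))
    spanning-pair {s} {t} u = ≡.subst (λ v → Spanning (_∈ᵥ (S s ∷ S t ∷ v))) (≡.sym (Vec.map-∘ S ι (toVec A)))
      (spanning-family (s ∷ t ∷ Vec.map ι (toVec A))
        (≡.subst (λ l → Unique (s ∷ t ∷ l)) (≡.sym (Vec.toList-map ι (toVec A))) u))

    D-indep : ∀ {s t} → Unique (s ∷ t ∷ map ι (elems A)) → D (S s) (S t) ≉ 0#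
    D-indep u = detB≉0 isB _ (spanning-pair u)

    pairsΙ : AllPairs (λ s t → Unique (s ∷ t ∷ map ι (elems A))) Ι
    pairsΙ = unique-pairs unique-N

    plücker : ∀ a b s t → D a b * D s t + D s b * D t a ≈ D s a * D t b
    -- An arc has at least |A| + 2 vectors, so I contains two, and these span the space together
    -- with A.
    plücker = go Ι pairsΙ (ℕ.+-cancelˡ-≤ ∣ A ∣ 2 _ (≡.subst₂ _≤_ (ℕ.+-comm 2 ∣ A ∣)
                 (≡.trans N≡ (≡.cong (∣ A ∣ ℕ.+_) (≡.sym lengthΙ))) (proj₁ arcS)))
      where
      go : ∀ Ι → AllPairs (λ s t → Unique (s ∷ t ∷ map ι (elems A))) Ι → 2 ≤ length Ι →
           ∀ a b s t → D a b * D s t + D s b * D t a ≈ D s a * D t b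
      go (s ∷ t ∷ _) ((u ∷ _) ∷ _) (s≤s (s≤s _)) = D-plücker (spanning-pair u)

  open Plane F D D-alt D-anti plücker D-pencil

  private
    I E : List (Vect k)
    I = map S Ι
    E = map (S ∘ ι) Xs

    I≡ : I ≡ E ++ map S Js
    I≡ = ≡.trans (List.map-++ S (map ι Xs) Js) (≡.cong (_++ map S Js) (≡.sym (List.map-∘ Xs)))

    ≁I : AllPairs Indep I
    ≁I = AllPairsP.map⁺ (AllPairs.map D-indep pairsΙ)

    ≁E : AllPairs Indep E
    ≁E = proj₁ (AllPairs-++⁻ E (≡.subst (AllPairs Indep) I≡ ≁I))

    lengthI : length I ≡ e ℕ.+ j
    lengthI = ≡.trans (List.length-map S Ι) lengthΙ

    Φ≈0 : Φ I E ≈ 0#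
    Φ≈0 = go Xs I≡ ≁I 1≤e (≡.trans (≡.cong (ℕ._+ e) lengthI) count)
      where
      go : ∀ Xs {I} → I ≡ map (S ∘ ι) Xs ++ map S Js → AllPairs Indep I → 1 ≤ length Xs →
           length I ℕ.+ length Xs ≡ 3 ℕ.+ order → Φ I (map (S ∘ ι) Xs) ≈ 0#
      go (x ∷ y ∷ Xs) {I} I≡ ≁ _ eq = Φ-vanishes (map (S ∘ ι) Xs) (map S Js) (Perm.↭-reflexive I≡) ≁
        (ℕ.suc-injective (ℕ.suc-injective (≡.trans
          (≡.cong (λ l → 2 ℕ.+ (l ℕ.+ length I)) (List.length-map (S ∘ ι) Xs))
          (≡.trans (ℕ.+-comm (2 ℕ.+ length Xs) (length I)) eq))))
      go (x ∷ []) {[]}        I≡ ≁ _ eq = contradiction (ℕ.suc-injective eq) λ ()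
      go (x ∷ []) {_ ∷ []}    I≡ ≁ _ eq = contradiction (ℕ.suc-injective (ℕ.suc-injective eq)) λ ()
      -- A single vector in E would force |I| = q + 2, one more than the number of directions.
      go (x ∷ []) {_ ∷ _ ∷ I} I≡ ≁ _ eq = contradiction (indep-length ≁) (ℕ.<⇒≱ (s≤s (ℕ.≤-reflexive
        (≡.sym (ℕ.+-cancelˡ-≡ 3 _ _ (≡.trans (ℕ.+-comm 1 (2 ℕ.+ length I)) eq))))))

    cross : All (λ u → All (λ x → Unique (u ∷ x ∷ elems A)) Xs) (elems U)
    cross = proj₁ (proj₂ (AllPairs-++⁻ (elems U) (unique-pairs unique-m)))

    ∉A : ∀ {x} → x ∈ₗ Xs → x ∉ A
    ∉A x∈ x∈A = All.lookup (All.lookup avoids x∈) (∈-elems A x∈A) ≡.refl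
      where
      avoids : All (λ x → All (x ≢_) (elems A)) Xs
      avoids = All.++⁻ʳ (elems U) (proj₁ (proj₂ (AllPairs-++⁻ (elems U ++ Xs) unique-m)))

    ∉U : ∀ {x} → x ∈ₗ Xs → x ∉ U
    ∉U x∈ x∈U with All.lookup (All.lookup cross (∈-elems U x∈U)) x∈
    ... | (x≢x ∷ _) ∷ _ = x≢x ≡.refl

    module _ {x : Fin m} (x∈ : x ∈ₗ Xs) (e : ∣ insert x A ∣ ≡ suc ∣ A ∣) where

      C = insert x A
      y = S (ι x)

      p : Insert y As (Vec.map (S ∘ ι) (cast e (toVec C)))
      p = Insert-map (S ∘ ι) (toVec-insert A (∉A x∈) e)

      -- The row y moves from its sorted place in C to the front of the rows of A. The sign depends
      -- on x alone and is common to all first rows v.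
      D′ : Vect k → Carrier
      D′ v = [-1]^ depth p * D v y

      detUC≈ : ∀ u → detUC u C e ≈ D′ u
      detUC≈ u = trans (detUC-rows ι S≈G u C e) (insert-sign {f = λ ws → detB isB (u ∷ ws)} (proj₁ (proj₂ (detB-altMultilinear isB)) u) p)

      detUC-G≈ : ∀ z → detUC (G z) C e ≈ D′ (S (ι z))
      detUC-G≈ z = trans (detUC-cong C e λ t → sym (S≈G z t)) (detUC≈ (S (ι z)))

      on-A : ∀ {a} → a ∈ₗ elems A → D′ (S (ι a)) ≈ 0#
      on-A a∈ = trans (*-congˡ (D-zeroˡ y (∈ᵥ.∈-map⁺ (S ∘ ι) (∈ᵥ.∈-toList⁻ a∈)))) (zeroʳ _)

      factor-S : prodL (allFin N) (λ s → inv (detUC (S s) C e)) ≈ prodL I (inv ∘ D′)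
      factor-S = begin
        prodL (allFin N) (λ s → inv (detUC (S s) C e))
          ≈⟨ prodL-cong (allFin N) (All.universal (λ s → inv-cong (detUC≈ (S s))) _) ⟩
        prodL (allFin N) (inv ∘ D′ ∘ S)
          ≈⟨ prodL-↭ perm-N ⟩
        prodL (map ι (elems A) ++ Ι) (inv ∘ D′ ∘ S)
          ≈⟨ prodL-++ (map ι (elems A)) ⟩
        prodL (map ι (elems A)) (inv ∘ D′ ∘ S) * prodL Ι (inv ∘ D′ ∘ S)
          ≈⟨ *-congʳ (prodL-one (map ι (elems A)) (All.map⁺ (All.tabulate λ a∈ → inv-zero (on-A a∈)))) ⟩
        1# * prodL Ι (inv ∘ D′ ∘ S)
          ≈⟨ *-identityˡ _ ⟩
        prodL Ι (inv ∘ D′ ∘ S)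
          ≡⟨ prodL-map S Ι ⟨
        prodL I (inv ∘ D′) ∎

      factor-G : prodL (allFin m) (λ z → inv (detUC (G z) C e)) ≈
                 prodL (elems U) (inv ∘ D′ ∘ S ∘ ι) * prodL E (inv ∘ D′)
      factor-G = begin
        prodL (allFin m) (λ z → inv (detUC (G z) C e))
          ≈⟨ prodL-cong (allFin m) (All.universal (λ z → inv-cong (detUC-G≈ z)) _) ⟩
        prodL (allFin m) g
          ≈⟨ prodL-↭ perm-m ⟩
        prodL (elems A ++ (elems U ++ Xs)) g
          ≈⟨ prodL-++ (elems A) ⟩
        prodL (elems A) g * prodL (elems U ++ Xs) g
          ≈⟨ *-cong (prodL-one (elems A) (All.tabulate λ a∈ → inv-zero (on-A a∈))) (prodL-++ (elems U)) ⟩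
        1# * (prodL (elems U) g * prodL Xs g)
          ≈⟨ *-identityˡ _ ⟩
        prodL (elems U) g * prodL Xs g
          ≡⟨ ≡.cong (prodL (elems U) g *_) (prodL-map (S ∘ ι) Xs) ⟨
        prodL (elems U) g * prodL E (inv ∘ D′) ∎
        where
        g = inv ∘ D′ ∘ S ∘ ι

      factor-U : prodU U C e ≈ prodL (elems U) (D′ ∘ S ∘ ι)
      factor-U = begin
        prodU U C e
          ≈⟨ prodF-cong ∣ U ∣ (λ i → trans (reflexive (≡.cong (λ i → detUC (G (lookup (toVec U) i)) C e) (Fin.cast-is-id ≡.refl i)))
                                          (detUC-G≈ (lookup (toVec U) i))) ⟩
        prodF (D′ ∘ S ∘ ι ∘ lookup (toVec U))
          ≡⟨ prodF-lookup (toVec U) ⟩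
        prodL (elems U) (D′ ∘ S ∘ ι) ∎

      -- Members of U differ from x and lie outside A, so their determinants are nonzero and `inv`
      -- gives genuine inverses.
      cancel-U : prodL (elems U) (inv ∘ D′ ∘ S ∘ ι) * prodL (elems U) (D′ ∘ S ∘ ι) ≈ 1#
      cancel-U = trans (sym (prodL-* (elems U) _ _)) (prodL-one (elems U) (All.map (λ {u} us →
        trans (*-comm _ _) (inv-inverse (*-nonzero ([-1]^≉0 (depth p)) (D-indep (Unique.map⁺ ι-injective (All.lookup us x∈)))))) cross))

      term : kernel C e * entry C e U A ≈ weight I y * weight E y
      term = begin
        kernel C e * entry C e U A
          ≡⟨ ≡.cong (kernel C e *_) (entry-inside e (⊆-insert A x) C⊆∁U) ⟩
        kernel C e * prodU U C e
          ≈⟨ *-cong (*-cong factor-S factor-G) factor-U ⟩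
        (prodL I (inv ∘ D′) * (ΠU⁻¹ * prodL E (inv ∘ D′))) * ΠU
          ≈⟨ solve 4 (λ i v e u → (i :* (v :* e)) :* u := (v :* u) :* (i :* e)) refl _ _ _ _ ⟩
        (ΠU⁻¹ * ΠU) * (prodL I (inv ∘ D′) * prodL E (inv ∘ D′))
          ≈⟨ *-cong cancel-U (weight-sign (depth p) ≁I ≁E (∈ₗ.∈-map⁺ S (∈ₗ.∈-++⁺ˡ (∈ₗ.∈-map⁺ ι x∈))) (∈ₗ.∈-map⁺ (S ∘ ι) x∈)
               (≡.trans (≡.cong₂ ℕ._+_ lengthI (List.length-map (S ∘ ι) Xs)) count)) ⟩
        1# * (weight I y * weight E y)
          ≈⟨ *-identityˡ _ ⟩
        weight I y * weight E y ∎
        where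
        ΠU⁻¹ = prodL (elems U) (inv ∘ D′ ∘ S ∘ ι)
        ΠU   = prodL (elems U) (D′ ∘ S ∘ ι)
        C⊆∁U : C ⊆ ∁ U
        C⊆∁U z∈ with ∈-insert⁻ A z∈
        ... | inj₁ ≡.refl = Subset.x∉p⇒x∈∁p (∉U x∈)
        ... | inj₂ z∈A    = A⊆∁U z∈A

  -- Of the sets `insert x A` only those with x in `Xs` contribute: for x in U the set meets U,
  -- where the entry is 0.
  column-vanishes : ∀ (h : Subset m → Carrier) →
    (∀ C e → h C ≈ kernel C e * entry C e U A) → (∀ C → ∣ C ∣ ≢ suc ∣ A ∣ → h C ≈ 0#) →
    sumL (allSubsets m) h ≈ 0#
  column-vanishes h h≈ h≈0 = begin
    sumL (allSubsets m) h
      ≈⟨ sum-supersets A h ((λ C A⊈C → entry-zero C λ e → entry-⊈ˡ e A⊈C) , h≈0) ⟩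
    sumF pick
      ≡⟨ sumF-tabulate m id ⟨
    sumL (allFin m) pick
      ≈⟨ sumL-↭ perm-m ⟩
    sumL (elems A ++ (elems U ++ Xs)) pick
      ≈⟨ trans (sumL-++ (elems A)) (+-congˡ (sumL-++ (elems U))) ⟩
    sumL (elems A) pick + (sumL (elems U) pick + sumL Xs pick)
      ≈⟨ +-cong (sumL-zero (elems A) (All.tabulate λ a∈ → pick-A (elems-∈ A a∈)))
                (+-cong (sumL-zero (elems U) (All.tabulate λ u∈ → pick-U (elems-∈ U u∈)))
                        (sumL-cong Xs (All.tabulate pick-X))) ⟩
    0# + (0# + sumL Xs (λ x → weight I (S (ι x)) * weight E (S (ι x))))
      ≈⟨ trans (+-identityˡ _) (+-identityˡ _) ⟩
    sumL Xs (λ x → weight I (S (ι x)) * weight E (S (ι x)))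
      ≡⟨ sumL-map (S ∘ ι) Xs ⟨
    Φ I E
      ≈⟨ Φ≈0 ⟩
    0# ∎
    where
    pick : Fin m → Carrier
    pick x = if lookup A x then 0# else h (insert x A)
    entry-zero : ∀ C → (∀ e → entry C e U A ≡ 0#) → h C ≈ 0#
    entry-zero C z with ∣ C ∣ ℕ.≟ suc ∣ A ∣
    ... | no  ≢ = h≈0 C ≢
    ... | yes e = trans (h≈ C e) (trans (*-congˡ (reflexive (z e))) (zeroʳ _))
    pick-A : ∀ {x} → x ∈ A → pick x ≈ 0#
    pick-A {x} x∈A rewrite Vec.[]=⇒lookup x∈A = refl
    pick-U : ∀ {x} → x ∈ U → pick x ≈ 0#
    pick-U {x} x∈U with lookup A x
    ... | true  = refl
    ... | false = entry-zero (insert x A) λ e → entry-⊈ʳ {A = A} e λ C⊆∁U →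
                    Subset.x∈∁p⇒x∉p (C⊆∁U (x∈insert A x)) x∈U
    pick-X : ∀ {x} → x ∈ₗ Xs → pick x ≈ weight I (S (ι x)) * weight E (S (ι x))
    pick-X {x} x∈ with lookup A x in eq
    ... | true  = contradiction (Vec.lookup⇒[]= x A eq) (∉A x∈)
    ... | false = trans (h≈ _ (∣insert∣ A (∉A x∈))) (term x∈ (∣insert∣ A (∉A x∈)))

-- Passing to all columns, and the contradiction with full row rank

strictlyIncreasing⇒injective : ∀ {m N} {ι : Fin m → Fin N} → StrictlyIncreasing ι → Injective _≡_ _≡_ ι
strictlyIncreasing⇒injective inc {x} {y} ιx≡ιy with Fin.<-cmp x y
... | tri< x<y _ _ = contradiction (≡.cong Fin.toℕ ιx≡ιy) (ℕ.<⇒≢ (inc x y x<y))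
... | tri≈ _ x≡y _ = x≡y
... | tri> _ _ y<x = contradiction (≡.cong Fin.toℕ (≡.sym ιx≡ιy)) (ℕ.<⇒≢ (inc y x y<x))

allFin-complement : ∀ {n} {xs : List (Fin n)} → Unique xs → ∃ λ zs → allFin n ↭ xs ++ zs
allFin-complement {n} {xs} u
  with Complement.complement (≡.setoid (Fin n)) u (All.universal ∈ₗ.∈-allFin xs)
... | zs , p = zs , Perm.↭ₛ⇒↭ p

module Columns (F : FiniteField) {m N : ℕ} where
  open LinAlg F
  open FiniteField F hiding (zero)

  kernel-column : ∀ {d n} (G : Fin m → Vect (suc d)) {B : Fin (suc d) → Vect (suc d)} (isB : IsBasis B)
    (S : Fin N → Vect (suc d)) → IsArc (suc d) S →
    (ι : Fin m → Fin N) → StrictlyIncreasing ι → (∀ i t → S (ι i) t ≈ G i t) →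
    n ℕ.+ d ≤ m → N ℕ.+ m ≡ order ℕ.+ 2 ℕ.* d ℕ.+ 1 ℕ.+ n →
    ∀ U A → ∣ U ∣ ≡ n → ∣ A ∣ ℕ.+ 2 ≡ suc d → A ⊆ ∁ U → ∀ h →
    (∀ C e → h C ≈ Kernel.kernel F G isB S C e * Mat.entry G isB C e U A) →
    (∀ C → ∣ C ∣ ≢ d → h C ≈ 0#) → sumL (allSubsets m) h ≈ 0#
  kernel-column G isB S arcS ι inc S≈G bound total U A ≡.refl ∣A∣+2 A⊆∁U
    -- Matching here replaces d by 1 + |A|, which gives the dimension the form 2 + |A| that `Column`
    -- expects.
    with ≡.refl ← ℕ.suc-injective (≡.trans (≡.sym ∣A∣+2) (ℕ.+-comm ∣ A ∣ 2)) =
    Column.column-vanishes F A U G isB S arcS ι ι-inj S≈G (proj₁ X) (proj₁ J)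
      (Perm.trans (proj₂ X) (PermP.++-assoc (elems A) (elems U) _))
      (Perm.trans (proj₂ J) (Perm.trans (PermP.++⁺ʳ _ (Perm.↭-reflexive (List.map-++ ι (elems A) (proj₁ X))))
                                        (PermP.++-assoc (map ι (elems A)) (map ι (proj₁ X)) _)))
      A⊆∁U bound total
    where
    ι-inj = strictlyIncreasing⇒injective inc
    X : ∃ λ Xs → allFin m ↭ (elems A ++ elems U) ++ Xs
    X = allFin-complement (Unique.++⁺ (elems-unique A) (elems-unique U)
      λ (x∈A , x∈U) → Subset.x∈∁p⇒x∉p (A⊆∁U (elems-∈ A x∈A)) (elems-∈ U x∈U))
    disjoint-X : Unique (elems A ++ proj₁ X)
    disjoint-X with AllPairs-++⁻ (elems A) (PermSP.Unique-resp-↭ (≡.setoid _)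
      (Perm.↭⇒↭ₛ (Perm.trans (proj₂ X) (PermP.++-assoc (elems A) (elems U) _))) (Unique.allFin⁺ m))
    ... | uA , c , r = AllPairsP.++⁺ uA (proj₂ (proj₂ (AllPairs-++⁻ (elems U) r))) (All.map (All.++⁻ʳ (elems U)) c)
    J : ∃ λ Js → allFin N ↭ map ι (elems A ++ proj₁ X) ++ Js
    J = allFin-complement (Unique.map⁺ ι-inj disjoint-X)

  module _ {d n : ℕ} where

    -- FullRowRank sums a function local to its where block, which has no name here;
    -- unification against the type of the hypothesis recovers it.
    rowTerm : ∀ {Q : Set} {h : Subset m → Subset m → Subset m → Carrier} →
      ((∀ U A → ∣ U ∣ ≡ n → ∣ A ∣ ℕ.+ 2 ≡ suc d → A ⊆ ∁ U → sumL (allSubsets m) (λ C → h C U A) ≈ 0#) → Q) →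
      Subset m → Subset m → Subset m → Carrier
    rowTerm {h = h} _ = h

    module _ (G : Fin m → Vect (suc d)) {B : Fin (suc d) → Vect (suc d)} (isB : IsBasis B)
      (full : Mat.FullRowRank G isB n) (c : (C : Subset m) → ∣ C ∣ ≡ d → Carrier) where

      rowTerm-yes : ∀ C e U A → rowTerm (full c) C U A ≈ c C e * Mat.entry G isB C e U A
      rowTerm-yes C e U A with ∣ C ∣ ℕ.≟ d
      ... | yes e′ = reflexive (≡.cong (λ e → c C e * Mat.entry G isB C e U A) (ℕ.≡-irrelevant e′ e))
      ... | no  ≢  = contradiction e ≢

      rowTerm-no : ∀ C U A → ∣ C ∣ ≢ d → rowTerm (full c) C U A ≈ 0#
      rowTerm-no C U A ≢ with ∣ C ∣ ℕ.≟ d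
      ... | yes e = contradiction e ≢
      ... | no _  = refl

open import Data.Nat using (_+_; _*_)

theorem1p4 : (F : FiniteField) → (d m n : ℕ)
    → (G : Fin m → LinAlg.Vect F (suc d)) → LinAlg.IsArc F (suc d) G
    → (B : Fin (suc d) → LinAlg.Vect F (suc d)) → (isB : LinAlg.IsBasis F B)
    → n + d ≤ m
    → 2 * m ≤ FiniteField.order F + 2 * d + n
    → LinAlg.Mat.FullRowRank F G isB n
    → (N : ℕ) → N + m ≡ FiniteField.order F + 2 * d + 1 + n
    → ¬ (Σ (Fin N → LinAlg.Vect F (suc d)) λ S → LinAlg.IsArc F (suc d) S × LinAlg.IsSubfamilyOf F G S)
theorem1p4 F d m n G _ B isB bound _ full N total (S , arcS , ι , inc , S≈G) =
  -- A single row is enough for the contradiction, since every entry of `kernel` is nonzero; d ≤ n +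
  -- d ≤ m provides one.
  let C , e = subset-of-size (ℕ.≤-trans (ℕ.m≤n+m d n) bound) in
  kernel≉0 C e (full kernel (λ U A ∣U∣ ∣A∣ A⊆∁U →
    kernel-column G isB S arcS ι inc S≈G bound total U A ∣U∣ ∣A∣ A⊆∁U _
      (λ C e → rowTerm-yes {n = n} G isB full kernel C e U A)
      (λ C → rowTerm-no {n = n} G isB full kernel C U A)) C e)
  where
  open Kernel F G isB S
  open Columns F {m} {N}
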